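{- Let $(G,\precsim)$ be a C-quasi-ordered group. There exists a valuation $v$ on $G$ with value set $\Gamma\cup\{\infty\}$, called the type-valuation associated to $\precsim$, such that the following holds: (i) For any $\gamma\in\Gamma$, $G^{\gamma}=\{g\in G\mid v(g)\geq\gamma\}$ and $G_{\gamma}=\{g\in G\mid v(g)>\gamma\}$ are $\precsim$-strictly convex subgroups of $G$. (ii) The quasi-order $\precsim_{\gamma}$ induced by $\precsim$ on $H_{\gamma}:=G^{\gamma}/G_{\gamma}$ is of elementary type. (iii) If $\gamma<\delta$ are elements of $\Gamma$ such that $\precsim_{\gamma}$ and $\precsim_{\delta}$ are both valuational, then there exists $\alpha$ between $\gamma$ and $\delta$ such that $\precsim_{\alpha}$ is order-type. Moreover, the quasi-order $\precsim$ can be obtained by lifting the family $(\precsim_{\gamma})_{\gamma\in\Gamma}$ to $G$ and then welding if necessary.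
   Context: Quasi-orders. A quasi-order is a reflexive, transitive and total binary relation $\precsim$; $a\sim b$ means $a\precsim b\precsim a$, $cl(a)$ is the $\sim$-class of $a$, and $a\precnsim b$ means $a\precsim b$ and $a\nsim b$. For subsets, $S\precsim T$ (resp. $S\precnsim T$) means $s\precsim t$ (resp. $s\precnsim t$) for all $s\in S$, $t\in T$ (a single element stands for its singleton). An element $c$ is between $a$ and $b$ if $a\precsim c\precsim b$ or $b\precsim c\precsim a$. $\max(S)=\{s\in S\mid t\precsim s\ \forall t\in S\}$. $S$ is strictly convex if $s,t\in S$ and $s\precnsim a\precnsim t$ imply $a\in S$. A coarsening of $\precsim$ is a quasi-order $\precsim_2$ such that $a\precsim b$ implies $a\precsim_2 b$. C-relations. A C-relation on a set is a ternary relation $C$ such that for all $x,y,z,w$: $C(x,y,z)\Rightarrow C(x,z,y)$; $C(x,y,z)\Rightarrow\neg C(y,x,z)$; $C(x,y,z)\Rightarrow C(w,y,z)\vee C(x,w,z)$; $x\neq y\Rightarrow C(x,y,y)$. On a group it is compatible if $C(x,y,z)$ implies $C(vxu,vyu,vzu)$ for all $x,y,z,u,v$. A C-quasi-order (C-q.o.) on a group $G$ is a quasi-order of the form $x\precsim y\Leftrightarrow\neg C(x,y,1)$ with $C$ a compatible C-relation (which is then unique: $C(x,y,z)\Leftrightarrow yz^{ -1}\precnsim xz^{ -1}$). A C-quasi-ordered group is a group with a C-q.o. Valuations. With $g^z:=zgz^{ -1}$, a valuation on a group $G$ is a map $v:G\to\Gamma\cup\{\infty\}$, $\Gamma$ totally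 ordered and $\gamma<\infty$ for all $\gamma\in\Gamma$, such that $v(g)=\infty\Leftrightarrow g=1$; $v(gh^{ -1})\geq\min(v(g),v(h))$; $v(g)\leq v(h)\Leftrightarrow v(g^z)\leq v(h^z)$. For every $\gamma\in\Gamma$, $G_\gamma$ is a normal subgroup of $G^\gamma$. Elementary type. A C-q.o. is order-type if its C-relation is $C(x,y,z)\Leftrightarrow(y<x\wedge z<x)\vee(y=z\neq x)$ for some total order on $G$ that is invariant under left and right multiplication; it is valuational if its C-relation is $C(x,y,z)\Leftrightarrow v(yz^{ -1})>v(xz^{ -1})$ for some valuation $v$ on $G$ (equivalently $g\precsim h\Leftrightarrow v(g)\geq v(h)$). It is of elementary type if it is order-type or valuational. Types and type-components. In a quasi-ordered group, $g$ is v-type if $g\sim g^{ -1}$; o-type if $g=1$ or $g\nsim g^{ -1}$; $o^+$-type if $g^{ -1}\precnsim g$; $o^-$-type if $g\precnsim g^{ -1}$. For $g\neq 1$ in $(G,\precsim)$, the type-component $T_g$ is: if $g$ is v-type, the set of v-type elements $h\neq1$ such that there is no $o^+$-type element between $h$ and $g$; if $g$ is $o^+$-type, $T_g:=T_g^+\cup T_g^-$ where $T_g^+$ is the set of $o^+$-type elements $h$ such that every element between $g$ and $h$ is $o^+$-type and $T_g^-:=(T_g^+)^{ -1}$; if $g$ is $o^-$-type, $T_g:=T_{g^{ -1}}$. Put $T_1:=\{1\}$. Type-valuation. The set of type-components is totally ordered by $T_g\leq T_h\Leftrightarrow(T_g=T_h$ or $T_g\precsim T_h)$. Let $\leq^{\ast}$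 be the reverse order. The type-valuation is $v(g):=T_g$, with values in the set of type-components ordered by $\leq^{\ast}$, where $T_1$ plays the role of $\infty$. Induced quasi-order. If $H$ is a strictly convex normal subgroup of a C-quasi-ordered group $(K,\precsim)$, the induced C-q.o. on $K/H$ is $gH\precsim hH\Leftrightarrow g\in H\vee(h\notin H\wedge g\precsim h)$. In (ii) take $K=G^\gamma$, $H=G_\gamma$. Lifting. Given a valuation $v:G\to\Gamma\cup\{\infty\}$ and quasi-orders $\precsim_\gamma$ on $G^\gamma/G_\gamma$ for $\gamma\in\Gamma$, the lifting of $(\precsim_\gamma)_{\gamma\in\Gamma}$ to $G$ is the quasi-order given by $g\precsim h\Leftrightarrow v(g)>v(h)\vee(v(g)=v(h)=\gamma\wedge gG_\gamma\precsim_\gamma hG_\gamma)$ (with $1\precsim 1$). Welding. Let $(G,\precsim)$ be a C-quasi-ordered group and let $g\in G$ be an $o^-$-type element. Put $G_g:=\{h\mid \{h,h^{ -1}\}\precsim g\}$ and $M_g:=\max(G_g)$, and suppose $M_g\neq\varnothing$. Then for every $z\in G$ the element $g^z$ is $o^-$-type and $M_{g^z}=\max(G_{g^z})$ is non-empty, and no element lies strictly between $M_{g^z}$ and $cl(g^z)$. Welding is the operation of passing from $\precsim$ to the coarsening $\precsim_2$ of $\precsim$ obtained by declaring $M_{g^z}\sim_2 g^z$ for every $z\in G$, i.e. by joining the sets $M_{g^z}$ and $cl(g^z)$ into one equivalence class for each $z\in G$ and changing nothing else; $\precsim_2$ is again a C-q.o. -}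

module Defs where

open import Level using (Level; _⊔_; suc)
open import Algebra.Bundles using (Group)
import Algebra.Properties.Group as GroupProperties
import Algebra.Construct.NaturalChoice.Min as Min
open import Data.Product using (∃; ∃₂; Σ-syntax; ∃-syntax; _×_; _,_; proj₁; proj₂)
open import Data.Sum using (_⊎_; inj₁; inj₂)
open import Function.Base using (_on_)
open import Function.Bundles using (_⇔_; Equivalence)
open import Relation.Binary.Bundles using (TotalOrder)
open import Relation.Binary.Core using (Rel)
open import Relation.Binary.Definitions using (_Respects_)
open import Relation.Binary.Structures
  using (IsTotalPreorder; IsStrictTotalOrder)
import Relation.Binary.Construct.Add.Supremum.Equality as SupEquality
import Relation.Binary.Construct.Add.Supremum.NonStrict as SupNonStrict
import Relation.Binary.Construct.NonStrictToStrict as NonStrictToStrict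
import Relation.Binary.Reasoning.Setoid as SetoidReasoning
open import Relation.Nullary.Construct.Add.Supremum using (_⁺; ⊤⁺; [_])
open import Relation.Nullary.Negation using (¬_)
open import Relation.Unary using (Pred; _∈_; _∉_; _⊆_; _∪_; _≐_; Satisfiable)

private
  variable
    a c ℓ r p q γ₁ γ₂ γ₃ : Level

module QuasiOrder {A : Set a} (_≲_ : Rel A r) where

  infix 4 _∼_ _⋨_ _≲ₛ_

  _∼_ : Rel A r
  x ∼ y = x ≲ y × y ≲ x

  _⋨_ : Rel A r
  x ⋨ y = x ≲ y × ¬ (x ∼ y)

  cl : A → Pred A r
  cl x y = y ∼ x

  _≲ₛ_ : Pred A p → Pred A q → Set (a ⊔ r ⊔ p ⊔ q)
  S ≲ₛ T = ∀ {s t} → s ∈ S → t ∈ T → s ≲ t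

  Between : A → A → Pred A r
  Between x y z = (x ≲ z × z ≲ y) ⊎ (y ≲ z × z ≲ x)

  max : Pred A p → Pred A (a ⊔ r ⊔ p)
  max S s = s ∈ S × (∀ {t} → t ∈ S → t ≲ s)

  StrictlyConvex : Pred A p → Set (a ⊔ r ⊔ p)
  StrictlyConvex S = ∀ {s t x} → s ∈ S → t ∈ S → s ⋨ x → x ⋨ t → x ∈ S

module Conjugation (G : Group c ℓ) where
  open Group G

  infixl 8 _^_

  _^_ : Carrier → Carrier → Carrier
  g ^ z = (z ∙ g) ∙ z ⁻¹

module _ (G : Group c ℓ) where
  open Group G
  open Conjugation G

  record IsSubgroup (P : Pred Carrier p) : Set (c ⊔ ℓ ⊔ p) where
    field
      resp      : P Respects _≈_
      ε-closed  : ε ∈ P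
      ∙-closed  : ∀ {g h} → g ∈ P → h ∈ P → g ∙ h ∈ P
      ⁻¹-closed : ∀ {g} → g ∈ P → g ⁻¹ ∈ P

  record IsNormalSubgroupOf (K : Pred Carrier p) (N : Pred Carrier q) : Set (c ⊔ ℓ ⊔ p ⊔ q) where
    field
      isSubgroup  : IsSubgroup N
      N⊆K         : N ⊆ K
      conj-closed : ∀ {z g} → z ∈ K → g ∈ N → g ^ z ∈ N

-- The group K/N has the elements of K as representatives, and two of them
-- are identified when g N = h N.
module _ (G : Group c ℓ) {K : Pred (Group.Carrier G) p} {N : Pred (Group.Carrier G) q}
         (K-sub : IsSubgroup G K) (N⊴K : IsNormalSubgroupOf G K N) where
  open Group G
  open GroupProperties G
  open SetoidReasoning setoid
  private
    module K = IsSubgroup K-sub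
    open IsNormalSubgroupOf N⊴K
    module N = IsSubgroup isSubgroup

    infix 4 _~_
    _~_ : Rel Carrier q
    g ~ h = g ⁻¹ ∙ h ∈ N

    ≈⇒~ : ∀ {g h} → g ≈ h → g ~ h
    ≈⇒~ {g} {h} g≈h = N.resp (trans (sym (inverseˡ g)) (∙-congˡ g≈h)) N.ε-closed

    ~-sym : ∀ {g h} → g ~ h → h ~ g
    ~-sym {g} {h} g~h = N.resp eq (N.⁻¹-closed g~h)
      where
      eq : (g ⁻¹ ∙ h) ⁻¹ ≈ h ⁻¹ ∙ g
      eq = trans (⁻¹-anti-homo-∙ _ _) (∙-congˡ (⁻¹-involutive g))

    ~-trans : ∀ {g h k} → g ~ h → h ~ k → g ~ k
    ~-trans {g} {h} {k} g~h h~k = N.resp eq (N.∙-closed g~h h~k)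
      where
      eq : (g ⁻¹ ∙ h) ∙ (h ⁻¹ ∙ k) ≈ g ⁻¹ ∙ k
      eq = begin
        (g ⁻¹ ∙ h) ∙ (h ⁻¹ ∙ k)  ≈⟨ assoc _ _ _ ⟩
        g ⁻¹ ∙ (h ∙ (h ⁻¹ ∙ k))  ≈⟨ ∙-congˡ (assoc _ _ _) ⟨
        g ⁻¹ ∙ ((h ∙ h ⁻¹) ∙ k)  ≈⟨ ∙-congˡ (∙-congʳ (inverseʳ h)) ⟩
        g ⁻¹ ∙ (ε ∙ k)           ≈⟨ ∙-congˡ (identityˡ k) ⟩
        g ⁻¹ ∙ k                 ∎

    ~-∙-cong : ∀ {g h k l} → k ∈ K → g ~ h → k ~ l → g ∙ k ~ h ∙ l
    ~-∙-cong {g} {h} {k} {l} k∈K g~h k~l =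
      N.resp eq (N.∙-closed (conj-closed (K.⁻¹-closed k∈K) g~h) k~l)
      where
      eq : ((k ⁻¹ ∙ (g ⁻¹ ∙ h)) ∙ k ⁻¹ ⁻¹) ∙ (k ⁻¹ ∙ l) ≈ (g ∙ k) ⁻¹ ∙ (h ∙ l)
      eq = begin
        ((k ⁻¹ ∙ (g ⁻¹ ∙ h)) ∙ k ⁻¹ ⁻¹) ∙ (k ⁻¹ ∙ l)  ≈⟨ assoc _ _ _ ⟩
        (k ⁻¹ ∙ (g ⁻¹ ∙ h)) ∙ (k ⁻¹ ⁻¹ ∙ (k ⁻¹ ∙ l))  ≈⟨ ∙-congˡ (assoc _ _ _) ⟨
        (k ⁻¹ ∙ (g ⁻¹ ∙ h)) ∙ ((k ⁻¹ ⁻¹ ∙ k ⁻¹) ∙ l)  ≈⟨ ∙-congˡ (∙-congʳ (inverseˡ _)) ⟩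
        (k ⁻¹ ∙ (g ⁻¹ ∙ h)) ∙ (ε ∙ l)                  ≈⟨ ∙-congˡ (identityˡ l) ⟩
        (k ⁻¹ ∙ (g ⁻¹ ∙ h)) ∙ l                        ≈⟨ ∙-congʳ (assoc _ _ _) ⟨
        ((k ⁻¹ ∙ g ⁻¹) ∙ h) ∙ l                        ≈⟨ assoc _ _ _ ⟩
        (k ⁻¹ ∙ g ⁻¹) ∙ (h ∙ l)                        ≈⟨ ∙-congʳ (⁻¹-anti-homo-∙ g k) ⟨
        (g ∙ k) ⁻¹ ∙ (h ∙ l)                           ∎

    ~-⁻¹-cong : ∀ {g h} → g ∈ K → g ~ h → g ⁻¹ ~ h ⁻¹
    ~-⁻¹-cong {g} {h} g∈K g~h = N.resp eq (conj-closed g∈K (~-sym g~h))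
      where
      eq : (g ∙ (h ⁻¹ ∙ g)) ∙ g ⁻¹ ≈ g ⁻¹ ⁻¹ ∙ h ⁻¹
      eq = begin
        (g ∙ (h ⁻¹ ∙ g)) ∙ g ⁻¹  ≈⟨ assoc _ _ _ ⟩
        g ∙ ((h ⁻¹ ∙ g) ∙ g ⁻¹)  ≈⟨ ∙-congˡ (assoc _ _ _) ⟩
        g ∙ (h ⁻¹ ∙ (g ∙ g ⁻¹))  ≈⟨ ∙-congˡ (∙-congˡ (inverseʳ g)) ⟩
        g ∙ (h ⁻¹ ∙ ε)           ≈⟨ ∙-congˡ (identityʳ _) ⟩
        g ∙ h ⁻¹                 ≈⟨ ∙-congʳ (⁻¹-involutive g) ⟨
        g ⁻¹ ⁻¹ ∙ h ⁻¹           ∎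

  quotientGroup : Group (c ⊔ p) q
  quotientGroup = record
    { Carrier = ∃ K
    ; _≈_     = _~_ on proj₁
    ; _∙_     = λ (g , g∈K) (h , h∈K) → g ∙ h , K.∙-closed g∈K h∈K
    ; ε       = ε , K.ε-closed
    ; _⁻¹     = λ (g , g∈K) → g ⁻¹ , K.⁻¹-closed g∈K
    ; isGroup = record
      { isMonoid = record
        { isSemigroup = record
          { isMagma = record
            { isEquivalence = record
              { refl = ≈⇒~ refl ; sym = ~-sym ; trans = ~-trans }
            ; ∙-cong = λ {_} {_} {(_ , k∈K)} → ~-∙-cong k∈K
            }
          ; assoc = λ _ _ _ → ≈⇒~ (assoc _ _ _)
          }
        ; identity = (λ _ → ≈⇒~ (identityˡ _)) , (λ _ → ≈⇒~ (identityʳ _))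
        }
      ; inverse = (λ _ → ≈⇒~ (inverseˡ _)) , (λ _ → ≈⇒~ (inverseʳ _))
      ; ⁻¹-cong = λ {(_ , g∈K)} → ~-⁻¹-cong g∈K
      }
    }

Induced : {A : Set a} → Rel A r → (K : Pred A p) → Pred A q → Rel (∃ K) (r ⊔ q)
Induced _≲_ K N (g , _) (h , _) = g ∈ N ⊎ (h ∉ N × g ≲ h)

module _ (G : Group c ℓ) where
  open Group G

  record IsCompatibleCRelation (C : Carrier → Carrier → Carrier → Set r) : Set (c ⊔ ℓ ⊔ r) where
    field
      C-cong     : ∀ {x x′ y y′ z z′} → x ≈ x′ → y ≈ y′ → z ≈ z′ → C x y z → C x′ y′ z′
      C-sym      : ∀ {x y z} → C x y z → C x z y
      C-asym     : ∀ {x y z} → C x y z → ¬ C y x z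
      C-split    : ∀ {x y z} w → C x y z → C w y z ⊎ C x w z
      C-diag     : ∀ {x y} → ¬ (x ≈ y) → C x y y
      compatible : ∀ {x y z} u v → C x y z → C (v ∙ x ∙ u) (v ∙ y ∙ u) (v ∙ z ∙ u)

  record IsCQuasiOrder (_≲_ : Rel Carrier r) : Set (c ⊔ ℓ ⊔ suc r) where
    field
      isTotalPreorder       : IsTotalPreorder _≈_ _≲_
      C                     : Carrier → Carrier → Carrier → Set r
      isCompatibleCRelation : IsCompatibleCRelation C
      ≲⇔¬C                  : ∀ {x y} → x ≲ y ⇔ (¬ C x y ε)

-- The total order Γ ∪ {∞}, with ∞ written ⊤⁺.
withTop : TotalOrder γ₁ γ₂ γ₃ → TotalOrder γ₁ (γ₁ ⊔ γ₂) (γ₁ ⊔ γ₃)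
withTop Γ = record
  { Carrier      = Γ.Carrier ⁺
  ; _≈_          = SupEquality._≈⁺_ Γ._≈_
  ; _≤_          = SupNonStrict._≤⁺_ Γ._≤_
  ; isTotalOrder = SupNonStrict.≤⁺-isTotalOrder Γ._≤_ Γ.isTotalOrder
  }
  where module Γ = TotalOrder Γ

module StrictOrder (Γ : TotalOrder γ₁ γ₂ γ₃) where
  open TotalOrder Γ
  open NonStrictToStrict _≈_ _≤_ public using (_<_)

module WithTop (Γ : TotalOrder γ₁ γ₂ γ₃) where
  open TotalOrder (withTop Γ) public
  open StrictOrder (withTop Γ) public
  open Min (withTop Γ) public using (_⊓_)

record Valuation (G : Group c ℓ) (Γ : TotalOrder γ₁ γ₂ γ₃) : Set (c ⊔ ℓ ⊔ γ₁ ⊔ γ₂ ⊔ γ₃) where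
  open Group G
  open Conjugation G
  module Γ⁺ = WithTop Γ
  field
    v      : Carrier → Γ⁺.Carrier
    v-cong : ∀ {g h} → g ≈ h → v g Γ⁺.≈ v h
    v-∞    : ∀ {g} → v g Γ⁺.≈ ⊤⁺ ⇔ g ≈ ε
    v-min  : ∀ g h → v g Γ⁺.⊓ v h Γ⁺.≤ v (g ∙ h ⁻¹)
    v-conj : ∀ g h z → v g Γ⁺.≤ v h ⇔ v (g ^ z) Γ⁺.≤ v (h ^ z)

module ResidueGroups {G : Group c ℓ} {Γ : TotalOrder γ₁ γ₂ γ₃} (V : Valuation G Γ) where
  open Group G
  open GroupProperties G
  open Conjugation G
  open Valuation V
  private
    module Γ = TotalOrder Γ
    open Min (withTop Γ) using (⊓-glb)

  G≥ : Γ.Carrier → Pred Carrier (γ₁ ⊔ γ₃)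
  G≥ γ g = [ γ ] Γ⁺.≤ v g

  G> : Γ.Carrier → Pred Carrier (γ₁ ⊔ γ₂ ⊔ γ₃)
  G> γ g = [ γ ] Γ⁺.< v g

  private
    ≤v-ε : ∀ x → x Γ⁺.≤ v ε
    ≤v-ε x = Γ⁺.trans (x SupNonStrict.≤⊤⁺) (Γ⁺.reflexive (Γ⁺.Eq.sym (Equivalence.from v-∞ refl)))

    v≤v-⁻¹ : ∀ g → v g Γ⁺.≤ v (g ⁻¹)
    v≤v-⁻¹ g = Γ⁺.trans (⊓-glb (≤v-ε (v g)) Γ⁺.refl)
                 (Γ⁺.trans (v-min ε g) (Γ⁺.reflexive (v-cong (identityˡ (g ⁻¹)))))

    ≤v-∙ : ∀ {x} g h → x Γ⁺.≤ v g → x Γ⁺.≤ v h → x Γ⁺.≤ v (g ∙ h)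
    ≤v-∙ g h x≤vg x≤vh =
      Γ⁺.trans (⊓-glb x≤vg (Γ⁺.trans x≤vh (v≤v-⁻¹ h)))
        (Γ⁺.trans (v-min g (h ⁻¹)) (Γ⁺.reflexive (v-cong (∙-congˡ (⁻¹-involutive h)))))

    <-≤-trans : ∀ {x y z} → x Γ⁺.< y → y Γ⁺.≤ z → x Γ⁺.< z
    <-≤-trans (x≤y , x≉y) y≤z =
      Γ⁺.trans x≤y y≤z ,
      λ x≈z → x≉y (Γ⁺.antisym x≤y (Γ⁺.trans y≤z (Γ⁺.reflexive (Γ⁺.Eq.sym x≈z))))

    <⇒≱ : ∀ {x y} → x Γ⁺.< y → ¬ (y Γ⁺.≤ x)
    <⇒≱ (x≤y , x≉y) y≤x = x≉y (Γ⁺.antisym x≤y y≤x)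

    <v-∙ : ∀ {x} g h → x Γ⁺.< v g → x Γ⁺.< v h → x Γ⁺.< v (g ∙ h)
    <v-∙ g h x<vg x<vh with Γ⁺.total (v g) (v h)
    ... | inj₁ vg≤vh = <-≤-trans x<vg (≤v-∙ g h Γ⁺.refl vg≤vh)
    ... | inj₂ vh≤vg = <-≤-trans x<vh (≤v-∙ g h vh≤vg Γ⁺.refl)

    ^-fixed : ∀ z → z ^ z ≈ z
    ^-fixed z = trans (assoc _ _ _) (trans (∙-congˡ (inverseʳ z)) (identityʳ z))

    v≤⇒v^≤ : ∀ {z g} → v z Γ⁺.≤ v g → v z Γ⁺.≤ v (g ^ z)
    v≤⇒v^≤ {z} {g} vz≤vg =
      Γ⁺.trans (Γ⁺.reflexive (v-cong (sym (^-fixed z)))) (Equivalence.to (v-conj z g z) vz≤vg)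

    v^≤⇒v≤ : ∀ {z g} → v (g ^ z) Γ⁺.≤ v z → v g Γ⁺.≤ v z
    v^≤⇒v≤ {z} {g} le =
      Equivalence.from (v-conj g z z) (Γ⁺.trans le (Γ⁺.reflexive (v-cong (sym (^-fixed z)))))

  G≥-isSubgroup : ∀ γ → IsSubgroup G (G≥ γ)
  G≥-isSubgroup γ = record
    { resp      = λ g≈h γ≤vg → Γ⁺.trans γ≤vg (Γ⁺.reflexive (v-cong g≈h))
    ; ε-closed  = ≤v-ε [ γ ]
    ; ∙-closed  = ≤v-∙ _ _
    ; ⁻¹-closed = λ {g} γ≤vg → Γ⁺.trans γ≤vg (v≤v-⁻¹ g)
    }

  G>-isSubgroup : ∀ γ → IsSubgroup G (G> γ)
  G>-isSubgroup γ = record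
    { resp      = λ g≈h γ<vg → <-≤-trans γ<vg (Γ⁺.reflexive (v-cong g≈h))
    ; ε-closed  = <-≤-trans ((_ SupNonStrict.≤⊤⁺) , λ ()) (≤v-ε ⊤⁺)
    ; ∙-closed  = <v-∙ _ _
    ; ⁻¹-closed = λ {g} γ<vg → <-≤-trans γ<vg (v≤v-⁻¹ g)
    }

  G>-isNormalSubgroupOf-G≥ : ∀ γ → IsNormalSubgroupOf G (G≥ γ) (G> γ)
  G>-isNormalSubgroupOf-G≥ γ = record
    { isSubgroup  = G>-isSubgroup γ
    ; N⊆K         = proj₁
    ; conj-closed = conj-closed
    }
    where
    open IsSubgroup (G>-isSubgroup γ)

    conj-closed : ∀ {z g} → z ∈ G≥ γ → g ∈ G> γ → g ^ z ∈ G> γ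
    conj-closed {z} {g} γ≤vz γ<vg with Γ⁺.total (v g) (v z)
    ... | inj₁ vg≤vz = ∙-closed (∙-closed z∈ γ<vg) (⁻¹-closed z∈)
      where
      z∈ : z ∈ G> γ
      z∈ = <-≤-trans γ<vg vg≤vz
    ... | inj₂ vz≤vg = Γ⁺.trans γ≤vz vz≤v^ , λ γ≈v^ →
      let v^≤γ = Γ⁺.reflexive (Γ⁺.Eq.sym γ≈v^)
          vg≤vz = v^≤⇒v≤ (Γ⁺.trans v^≤γ γ≤vz)
      in <⇒≱ γ<vg (Γ⁺.trans vg≤vz (Γ⁺.trans vz≤v^ v^≤γ))
      where
      vz≤v^ : v z Γ⁺.≤ v (g ^ z)
      vz≤v^ = v≤⇒v^≤ vz≤vg

  H : Γ.Carrier → Group (c ⊔ γ₁ ⊔ γ₃) (γ₁ ⊔ γ₂ ⊔ γ₃)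
  H γ = quotientGroup G (G≥-isSubgroup γ) (G>-isNormalSubgroupOf-G≥ γ)

  Residue : Rel Carrier r → ∀ γ → Rel (Group.Carrier (H γ)) (r ⊔ γ₁ ⊔ γ₂ ⊔ γ₃)
  Residue _≲_ γ = Induced _≲_ (G≥ γ) (G> γ)

  -- The last disjunct is 1 ≲ 1: both elements have value ∞.
  Lifting : (∀ γ → Rel (Group.Carrier (H γ)) q) → Rel Carrier (ℓ ⊔ γ₁ ⊔ γ₂ ⊔ γ₃ ⊔ q)
  Lifting _≲_[_]_ g h =
      v h Γ⁺.< v g
    ⊎ (∃[ γ ] Σ[ vg≈γ ∈ v g Γ⁺.≈ [ γ ] ] Σ[ vh≈γ ∈ v h Γ⁺.≈ [ γ ] ]
         _≲_[_]_ γ (g , Γ⁺.reflexive (Γ⁺.Eq.sym vg≈γ)) (h , Γ⁺.reflexive (Γ⁺.Eq.sym vh≈γ)))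
    ⊎ (g ≈ ε × h ≈ ε)

module _ (G : Group c ℓ) (_≲_ : Rel (Group.Carrier G) r) where
  open Group G

  record IsOrderType : Set (c ⊔ ℓ ⊔ suc r) where
    field
      isCQuasiOrder      : IsCQuasiOrder G _≲_
    open IsCQuasiOrder isCQuasiOrder using (C)
    infix 4 _<_
    field
      _<_                : Rel Carrier r
      isStrictTotalOrder : IsStrictTotalOrder _≈_ _<_
      <-invˡ             : ∀ {x y} z → x < y → z ∙ x < z ∙ y
      <-invʳ             : ∀ {x y} z → x < y → x ∙ z < y ∙ z
      C⇔                 : ∀ {x y z} →
                           C x y z ⇔ ((y < x × z < x) ⊎ (y ≈ z × ¬ (z ≈ x)))

  record IsValuational : Set (c ⊔ ℓ ⊔ suc (c ⊔ ℓ ⊔ r)) where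
    field
      isCQuasiOrder : IsCQuasiOrder G _≲_
    open IsCQuasiOrder isCQuasiOrder using (C)
    field
      Γ             : TotalOrder (c ⊔ ℓ) r r
      valuation     : Valuation G Γ
    open Valuation valuation
    field
      C⇔            : ∀ {x y z} → C x y z ⇔ v (x ∙ z ⁻¹) Γ⁺.< v (y ∙ z ⁻¹)

  IsElementaryType : Set (suc (c ⊔ ℓ ⊔ r))
  IsElementaryType = IsOrderType ⊎ IsValuational

module Types (G : Group c ℓ) (_≲_ : Rel (Group.Carrier G) r) where
  open Group G
  open QuasiOrder _≲_

  V-type O⁺-type O⁻-type : Pred Carrier r
  V-type  g = g ∼ g ⁻¹
  O⁺-type g = g ⁻¹ ⋨ g
  O⁻-type g = g ⋨ g ⁻¹

  T⁺ : Carrier → Pred Carrier (c ⊔ r)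
  T⁺ g h = O⁺-type h × (∀ {k} → k ∈ Between g h → O⁺-type k)

  T⁻ : Carrier → Pred Carrier (c ⊔ r)
  T⁻ g h = h ⁻¹ ∈ T⁺ g

  data T (g : Carrier) : Pred Carrier (c ⊔ ℓ ⊔ r) where
    T-1  : ∀ {h} → g ≈ ε → h ≈ ε → T g h
    T-v  : ∀ {h} → ¬ (g ≈ ε) → V-type g →
           V-type h → ¬ (h ≈ ε) → ¬ (∃[ k ] k ∈ Between h g × O⁺-type k) → T g h
    T-o⁺ : ∀ {h} → O⁺-type g → h ∈ T⁺ g ∪ T⁻ g → T g h
    T-o⁻ : ∀ {h} → O⁻-type g → h ∈ T⁺ (g ⁻¹) ∪ T⁻ (g ⁻¹) → T g h

  infix 4 _≤ᵀ_
  _≤ᵀ_ : Rel Carrier (c ⊔ ℓ ⊔ r)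
  g ≤ᵀ h = T g ≐ T h ⊎ T g ≲ₛ T h

  -- Γ ∪ {∞} is the set of type-components T g, reversely ordered, with T ε as
  -- ∞, and v g = T g.  That v takes T ε, and only T ε, to ∞ is v-∞.
  record IsTypeValuation {Γ : TotalOrder γ₁ γ₂ γ₃} (V : Valuation G Γ)
         : Set (c ⊔ ℓ ⊔ r ⊔ γ₁ ⊔ γ₂ ⊔ γ₃) where
    open Valuation V
    field
      v-onto : ∀ γ → ∃[ g ] v g Γ⁺.≈ γ
      v-≈    : ∀ {g h} → v g Γ⁺.≈ v h ⇔ T g ≐ T h
      v-≤    : ∀ {g h} → v g Γ⁺.≤ v h ⇔ h ≤ᵀ g

module Welding (G : Group c ℓ) (_≲_ : Rel (Group.Carrier G) r) where
  open Group G
  open Conjugation G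
  open QuasiOrder _≲_
  open Types G _≲_ using (O⁻-type)

  M : Carrier → Pred Carrier (c ⊔ r)
  M g = max (λ h → h ≲ g × (h ⁻¹) ≲ g)

  Weldable : Pred Carrier (c ⊔ r)
  Weldable g = O⁻-type g × Satisfiable (M g)

  -- Simultaneous welding at all the elements g of W: for every z, the sets
  -- M (g ^ z) and cl (g ^ z) become one class.
  Weld : Pred Carrier p → Rel Carrier (c ⊔ r ⊔ p)
  Weld W x y =
    x ≲ y ⊎ (∃₂ λ g z → g ∈ W × x ∈ M (g ^ z) ∪ cl (g ^ z) × y ∈ M (g ^ z) ∪ cl (g ^ z))

-- Welding one g only affects the conjugates of g, whereas a C-quasi-order can
-- have many non-conjugate welded places; hence a set W of elements, possibly
-- empty.
ObtainedByWelding : (G : Group c ℓ) (_≲_ : Rel (Group.Carrier G) r)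
                    (_≲₂_ : Rel (Group.Carrier G) q) → Set (suc c ⊔ ℓ ⊔ suc r ⊔ q)
ObtainedByWelding {c = c} {r = r} G _≲_ _≲₂_ =
  IsCQuasiOrder G _≲_ ×
  (Σ[ W ∈ Pred Carrier (c ⊔ r) ] W ⊆ Weldable × (∀ x y → x ≲₂ y ⇔ Weld W x y))
  where
  open Group G
  open Welding G _≲_

{-# OPTIONS --safe #-}

-- Write x < y for ¬ y ≲ x.  A C-quasi-order is a conjugation-invariant total
-- preorder with least element 1 such that x ≲ y ⇔ xy⁻¹ ≲ y⁻¹.  The key consequence
-- is that n < k ≲ n⁻¹ forces k⁻¹ ∼ n: everything between an o⁻-type element and its
-- inverse is o⁺-type, so the o-type components correspond to the ∼-classes of
-- o⁻-type elements n.  For such n, and for n = 1, the sets {x ∣ x ≲ n and x⁻¹ ≲ n}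
-- and {x ∣ x ≲ n or x⁻¹ ≲ n} are subgroups and initial segments.  Let g ⊑ h mean
-- that each of these subgroups containing h contains g.  This total preorder,
-- reversed, is a valuation, and its classes are the type-components.
--
-- At an o-type component the residue is ordered by the positive cone {x ∣ n < x};
-- at a v-type component ≲ reversed is itself a valuation; two v-type components
-- are separated by some o⁻-type n.  The lifting relates x and y as ≲ does, except
-- when x ≲ y although y has strictly larger value.  Then x is o⁻-type and y ∈ M x,
-- and welding at these x recovers ≲.
module Submission where

open import Defs
open import Level using (Level; _⊔_; Lift; lift)
open import Algebra.Bundles using (Group)
import Algebra.Construct.NaturalChoice.Min as Min
import Algebra.Properties.Group as GroupProperties
open import Axiom.DoubleNegationElimination using (em⇒dne)
open import Axiom.ExcludedMiddle using (ExcludedMiddle)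
open import Data.Empty using (⊥-elim)
open import Data.Product using (Σ-syntax; ∃₂; ∃-syntax; _×_; _,_; proj₁; proj₂; swap)
open import Data.Sum using (_⊎_; inj₁; inj₂; [_,_]′)
import Data.Sum as Sum
open import Function.Base using (_∘_; case_of_; id)
open import Function.Bundles using (_⇔_; mk⇔; Equivalence)
open import Relation.Binary.Bundles using (TotalOrder)
open import Relation.Binary.Core using (Rel)
open import Relation.Binary.Structures using (IsTotalPreorder; IsStrictTotalOrder)
open import Relation.Binary.Definitions using (Tri; tri<; tri≈; tri>)
import Relation.Binary.Construct.Add.Supremum.Equality as SupEquality
import Relation.Binary.Construct.Add.Supremum.NonStrict as SupNonStrict
import Relation.Binary.Reasoning.Setoid as SetoidReasoning
open import Relation.Nullary using (¬_; Dec; yes; no)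
open import Relation.Nullary.Decidable using (toSum)
open import Relation.Nullary.Construct.Add.Supremum using (_⁺; ⊤⁺; [_])
open import Relation.Unary using (Pred; _∈_; _∉_; _⊆_; _≐_)

private
  variable
    c ℓ r γ₁ γ₂ γ₃ : Level

-- Identities for conjugates and quotients.

module ConjugationProperties (G : Group c ℓ) where
  open Group G
  open GroupProperties G
  open Conjugation G
  open SetoidReasoning setoid

  ^-congˡ : ∀ {x y} z → x ≈ y → x ^ z ≈ y ^ z
  ^-congˡ z x≈y = ∙-congʳ (∙-congˡ x≈y)

  ε^z≈ε : ∀ z → ε ^ z ≈ ε
  ε^z≈ε z = trans (∙-congʳ (identityʳ z)) (inverseʳ z)

  x^ε≈x : ∀ x → x ^ ε ≈ x
  x^ε≈x x = trans (∙-cong (identityˡ x) ε⁻¹≈ε) (identityʳ x)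

  ^-homo-∙ : ∀ x y z → (x ∙ y) ^ z ≈ x ^ z ∙ y ^ z
  ^-homo-∙ x y z = begin
    (z ∙ (x ∙ y)) ∙ z ⁻¹                ≈⟨ ∙-congʳ (assoc z x y) ⟨
    ((z ∙ x) ∙ y) ∙ z ⁻¹                ≈⟨ ∙-congʳ (∙-congˡ (\\-leftDividesʳ z y)) ⟨
    ((z ∙ x) ∙ (z ⁻¹ ∙ (z ∙ y))) ∙ z ⁻¹ ≈⟨ ∙-congʳ (assoc (z ∙ x) (z ⁻¹) (z ∙ y)) ⟨
    (x ^ z ∙ (z ∙ y)) ∙ z ⁻¹            ≈⟨ assoc (x ^ z) (z ∙ y) (z ⁻¹) ⟩
    x ^ z ∙ y ^ z                       ∎

  ^-⁻¹-comm : ∀ x z → (x ⁻¹) ^ z ≈ (x ^ z) ⁻¹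
  ^-⁻¹-comm x z = inverseˡ-unique _ _ (begin
    (x ⁻¹) ^ z ∙ x ^ z ≈⟨ ^-homo-∙ (x ⁻¹) x z ⟨
    (x ⁻¹ ∙ x) ^ z     ≈⟨ ^-congˡ z (inverseˡ x) ⟩
    ε ^ z              ≈⟨ ε^z≈ε z ⟩
    ε                  ∎)

  ^-^ : ∀ x y z → (x ^ y) ^ z ≈ x ^ (z ∙ y)
  ^-^ x y z = begin
    (z ∙ ((y ∙ x) ∙ y ⁻¹)) ∙ z ⁻¹ ≈⟨ ∙-congʳ (assoc z (y ∙ x) (y ⁻¹)) ⟨
    ((z ∙ (y ∙ x)) ∙ y ⁻¹) ∙ z ⁻¹ ≈⟨ assoc _ (y ⁻¹) (z ⁻¹) ⟩
    (z ∙ (y ∙ x)) ∙ (y ⁻¹ ∙ z ⁻¹) ≈⟨ ∙-cong (assoc z y x) (⁻¹-anti-homo-∙ z y) ⟨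
    ((z ∙ y) ∙ x) ∙ (z ∙ y) ⁻¹    ∎

  ^-inverse : ∀ {y z} x → z ∙ y ≈ ε → (x ^ y) ^ z ≈ x
  ^-inverse {y} {z} x zy≈ε = begin
    (x ^ y) ^ z ≈⟨ ^-^ x y z ⟩
    x ^ (z ∙ y) ≈⟨ ∙-cong (∙-congʳ zy≈ε) (⁻¹-cong zy≈ε) ⟩
    x ^ ε       ≈⟨ x^ε≈x x ⟩
    x           ∎

  ^-inverseˡ : ∀ x z → (x ^ z) ^ (z ⁻¹) ≈ x
  ^-inverseˡ x z = ^-inverse x (inverseˡ z)

  ^-inverseʳ : ∀ x z → (x ^ (z ⁻¹)) ^ z ≈ x
  ^-inverseʳ x z = ^-inverse x (inverseʳ z)

  y⁻¹∙x^y≈x∙y⁻¹ : ∀ x y → (y ⁻¹ ∙ x) ^ y ≈ x ∙ y ⁻¹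
  y⁻¹∙x^y≈x∙y⁻¹ x y = ∙-congʳ (\\-leftDividesˡ y x)

  x^x≈x : ∀ x → x ^ x ≈ x
  x^x≈x x = //-rightDividesʳ x x

  //-cancelʳ : ∀ x y z → (x ∙ z) ∙ (y ∙ z) ⁻¹ ≈ x ∙ y ⁻¹
  //-cancelʳ x y z = begin
    (x ∙ z) ∙ (y ∙ z) ⁻¹     ≈⟨ ∙-congˡ (⁻¹-anti-homo-∙ y z) ⟩
    (x ∙ z) ∙ (z ⁻¹ ∙ y ⁻¹)  ≈⟨ assoc _ _ _ ⟨
    ((x ∙ z) ∙ z ⁻¹) ∙ y ⁻¹  ≈⟨ ∙-congʳ (//-rightDividesʳ z x) ⟩
    x ∙ y ⁻¹                 ∎

  //-cancelˡ : ∀ x y z → (z ∙ x) ∙ (z ∙ y) ⁻¹ ≈ (x ∙ y ⁻¹) ^ z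
  //-cancelˡ x y z = begin
    (z ∙ x) ∙ (z ∙ y) ⁻¹     ≈⟨ ∙-congˡ (⁻¹-anti-homo-∙ z y) ⟩
    (z ∙ x) ∙ (y ⁻¹ ∙ z ⁻¹)  ≈⟨ assoc _ _ _ ⟨
    ((z ∙ x) ∙ y ⁻¹) ∙ z ⁻¹  ≈⟨ ∙-congʳ (assoc z x (y ⁻¹)) ⟩
    (x ∙ y ⁻¹) ^ z           ∎

  //-cancel : ∀ x y u v → (v ∙ x ∙ u) ∙ (v ∙ y ∙ u) ⁻¹ ≈ (x ∙ y ⁻¹) ^ v
  //-cancel x y u v = trans (//-cancelʳ (v ∙ x) (v ∙ y) u) (//-cancelˡ x y v)

-- A C-quasi-order in terms of ≲ alone: ≲-cancel is the symmetry C(x,y,z) ⇒ C(x,z,y)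
-- read through C(x,y,z) ⇔ yz⁻¹ ⋨ xz⁻¹.
record CQuasiOrderLaws (G : Group c ℓ) (_≲_ : Rel (Group.Carrier G) r) : Set (c ⊔ ℓ ⊔ r) where
  open Group G
  open Conjugation G
  field
    isTotalPreorder : IsTotalPreorder _≈_ _≲_
    ≲ε⇒≈ε           : ∀ {x} → x ≲ ε → x ≈ ε
    ^-mono          : ∀ {x y} z → x ≲ y → (x ^ z) ≲ (y ^ z)
    ≲-cancel        : ∀ {x y} → (x ∙ y ⁻¹) ≲ (y ⁻¹) → x ≲ y

-- Passage between C-relations and the laws for `≲`.

module _ {G : Group c ℓ} {_≲_ : Rel (Group.Carrier G) r} where
  open Group G
  open GroupProperties G
  open Conjugation G
  open ConjugationProperties G

  fromCQuasiOrder : ExcludedMiddle ℓ → IsCQuasiOrder G _≲_ → CQuasiOrderLaws G _≲_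
  fromCQuasiOrder em isC = record
    { isTotalPreorder = isTotalPreorder
    ; ≲ε⇒≈ε    = λ x≲ε → em⇒dne em λ x≉ε → to ≲⇔¬C x≲ε (C-diag x≉ε)
    ; ^-mono   = λ {x} {y} z x≲y → from ≲⇔¬C λ C^ → to ≲⇔¬C x≲y
        (C-cong (shift x z) (shift y z) (shift-ε z) (compatible z (z ⁻¹) C^))
    -- Swapping the last two arguments gives `C x ε y`; multiplying on the right by `y ⁻¹` turns
    -- this into `C (x ∙ y ⁻¹) (y ⁻¹) ε`, against `le`.
    ; ≲-cancel = λ {x} {y} le → from ≲⇔¬C λ Cxyε → to ≲⇔¬C le
        (C-cong (∙-congʳ (identityˡ x)) (trans (∙-congʳ (identityˡ ε)) (identityˡ _))
                (trans (∙-congʳ (identityˡ y)) (inverseʳ y))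
                (compatible (y ⁻¹) ε (C-sym Cxyε)))
    }
    where
    open IsCQuasiOrder isC
    open IsCompatibleCRelation isCompatibleCRelation
    open Equivalence
    shift : ∀ x z → (z ⁻¹ ∙ (x ^ z)) ∙ z ≈ x
    shift x z = trans (∙-congʳ (trans (∙-congˡ (assoc z x (z ⁻¹))) (\\-leftDividesʳ z _)))
                      (//-rightDividesˡ z x)
    shift-ε : ∀ z → (z ⁻¹ ∙ ε) ∙ z ≈ ε
    shift-ε z = trans (∙-congʳ (identityʳ _)) (inverseˡ z)

  toCQuasiOrder : ExcludedMiddle r → CQuasiOrderLaws G _≲_ → IsCQuasiOrder G _≲_
  toCQuasiOrder em laws = record
    { isTotalPreorder = isTotalPreorder
    -- By totality this negation is the strict relation `y ∙ z ⁻¹ ⋨ x ∙ z ⁻¹`.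
    ; C = λ x y z → ¬ ((x ∙ z ⁻¹) ≲ (y ∙ z ⁻¹))
    ; isCompatibleCRelation = record
      { C-cong = λ x≈ y≈ z≈ ¬le le → ¬le
          (≲-resp (∙-cong (sym x≈) (⁻¹-cong (sym z≈))) (∙-cong (sym y≈) (⁻¹-cong (sym z≈))) le)
      ; C-sym = λ {x} {y} {z} ¬le le → ¬le (≲-cancel
          (≲-resp (sym (//-cancelʳ x y (z ⁻¹))) (sym (⁻¹-anti-homo-// y z)) le))
      ; C-asym = λ ¬le ¬ge → [ ¬le , ¬ge ]′ (total _ _)
      ; C-split = λ {x} {y} {z} w ¬le → split ¬le em
      ; C-diag = λ {x} {y} x≉y le → x≉y (x∙y⁻¹≈ε⇒x≈y x y (≲ε⇒≈ε (≲-resp refl (inverseʳ y) le)))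
      ; compatible = λ {x} {y} {z} u v ¬le le → ¬le
          (≲-resp (^-inverseˡ _ v) (^-inverseˡ _ v)
            (^-mono (v ⁻¹) (≲-resp (//-cancel x z u v) (//-cancel y z u v) le)))
      }
    ; ≲⇔¬C = λ {x} {y} → mk⇔
        (λ x≲y ¬le → ¬le (≲-resp (sym (x∙ε⁻¹≈x x)) (sym (x∙ε⁻¹≈x y)) x≲y))
        (λ ¬¬le → ≲-resp (x∙ε⁻¹≈x x) (x∙ε⁻¹≈x y) (em⇒dne em ¬¬le))
    }
    where
    open CQuasiOrderLaws laws
    open IsTotalPreorder isTotalPreorder using (total; ≲-respˡ-≈; ≲-respʳ-≈) renaming (trans to ≲-trans)
    ≲-resp : ∀ {x x′ y y′} → x ≈ x′ → y ≈ y′ → x ≲ y → x′ ≲ y′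
    ≲-resp x≈ y≈ le = ≲-respˡ-≈ x≈ (≲-respʳ-≈ y≈ le)
    x∙ε⁻¹≈x : ∀ x → x ∙ ε ⁻¹ ≈ x
    x∙ε⁻¹≈x x = trans (∙-congˡ ε⁻¹≈ε) (identityʳ x)
    split : ∀ {a b w} → ¬ (a ≲ b) → Dec (w ≲ b) → ¬ (w ≲ b) ⊎ ¬ (a ≲ w)
    split a≴b (yes w≲b) = inj₂ λ a≲w → a≴b (≲-trans a≲w w≲b)
    split a≴b (no w≴b)  = inj₁ w≴b

-- Inverses and products under `≲`.

module CQuasiOrderProperties (em : ∀ {a} → ExcludedMiddle a) {G : Group c ℓ}
                             {R : Rel (Group.Carrier G) r} (laws : CQuasiOrderLaws G R) where
  open Group G
  open GroupProperties G
  open Conjugation G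
  open ConjugationProperties G
  open CQuasiOrderLaws laws
  open QuasiOrder R using (_∼_; _⋨_)
  open IsTotalPreorder isTotalPreorder public
    using (≲-respˡ-≈; ≲-respʳ-≈)
    renaming (refl to ≲-refl; reflexive to ≲-reflexive; trans to ≲-trans; total to ≲-total)

  private
    dne : ∀ {a} {A : Set a} → ¬ ¬ A → A
    dne = em⇒dne em

  infix 4 _≲_ _<_
  _≲_ _<_ : Rel Carrier r
  _≲_ = R
  x < y = ¬ y ≲ x

  ≲-resp : ∀ {x x′ y y′} → x ≈ x′ → y ≈ y′ → x ≲ y → x′ ≲ y′
  ≲-resp x≈ y≈ le = ≲-respˡ-≈ x≈ (≲-respʳ-≈ y≈ le)

  <⇒≲ : ∀ {x y} → x < y → x ≲ y
  <⇒≲ x<y = [ id , ⊥-elim ∘ x<y ]′ (≲-total _ _)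

  <⇒⋨ : ∀ {x y} → x < y → x ⋨ y
  <⇒⋨ x<y = <⇒≲ x<y , x<y ∘ proj₂

  ⋨⇒< : ∀ {x y} → x ⋨ y → x < y
  ⋨⇒< (x≲y , x≁y) y≲x = x≁y (x≲y , y≲x)

  x<x⁻¹⇒x⁻¹⁻¹<x⁻¹ : ∀ {x} → x < x ⁻¹ → x ⁻¹ ⁻¹ < x ⁻¹
  x<x⁻¹⇒x⁻¹⁻¹<x⁻¹ x<x⁻¹ = x<x⁻¹ ∘ ≲-respʳ-≈ (⁻¹-involutive _)

  x⁻¹<x⇒x⁻¹<x⁻¹⁻¹ : ∀ {x} → x ⁻¹ < x → x ⁻¹ < x ⁻¹ ⁻¹
  x⁻¹<x⇒x⁻¹<x⁻¹⁻¹ x⁻¹<x = x⁻¹<x ∘ ≲-respˡ-≈ (⁻¹-involutive _)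

  ≲-cancelˡ : ∀ {x y} → y ⁻¹ ∙ x ≲ y ⁻¹ → x ≲ y
  ≲-cancelˡ {x} {y} le =
    ≲-cancel (≲-resp (y⁻¹∙x^y≈x∙y⁻¹ x y) (trans (∙-congʳ (inverseʳ y)) (identityˡ _)) (^-mono y le))

  -- The converse of `≲-cancel` is `≲-cancel` itself, taken at `x ∙ y ⁻¹` and `y ⁻¹`.
  x≲y⇒x∙y⁻¹≲y⁻¹ : ∀ {x y} → x ≲ y → x ∙ y ⁻¹ ≲ y ⁻¹
  x≲y⇒x∙y⁻¹≲y⁻¹ {x} {y} x≲y =
    ≲-cancel (≲-resp (sym (//-rightDividesʳ (y ⁻¹) x)) (sym (⁻¹-involutive y)) x≲y)

  x≲y⁻¹⇒x∙y≲y : ∀ {x y} → x ≲ y ⁻¹ → x ∙ y ≲ y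
  x≲y⁻¹⇒x∙y≲y {x} {y} x≲y⁻¹ =
    ≲-resp (∙-congˡ (⁻¹-involutive y)) (⁻¹-involutive y) (x≲y⇒x∙y⁻¹≲y⁻¹ x≲y⁻¹)

  x≲y⁻¹⇒y∙x≲y : ∀ {x y} → x ≲ y ⁻¹ → y ∙ x ≲ y
  x≲y⁻¹⇒y∙x≲y {x} {y} x≲y⁻¹ =
    ≲-resp (trans (^-congˡ y (sym (x^y⁻¹ x y))) (^-inverseʳ _ y)) (x^x≈x y)
           (^-mono y (x≲y⁻¹⇒x∙y≲y x≲y⁻¹))
    where
    x^y⁻¹ : ∀ x y → (y ∙ x) ^ (y ⁻¹) ≈ x ∙ y
    x^y⁻¹ x y = ∙-cong (\\-leftDividesʳ y x) (⁻¹-involutive y)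

  -- Otherwise `n ⁻¹ ≲ n ⁻¹ ∙ k ⁻¹`, whose right side is `(k ∙ n) ⁻¹`. Cancelling gives `k ≲ k ∙ n`,
  -- while `k ≲ n ⁻¹` gives `k ∙ n ≲ n`; so `k ≲ n`.
  n<k≲n⁻¹⇒k⁻¹≲n : ∀ {n k} → n < k → k ≲ n ⁻¹ → k ⁻¹ ≲ n
  n<k≲n⁻¹⇒k⁻¹≲n {n} {k} n<k k≲n⁻¹ = ≲-cancelˡ (<⇒≲ n⁻¹∙k⁻¹<n⁻¹)
    where
    n⁻¹∙k⁻¹<n⁻¹ : n ⁻¹ ∙ k ⁻¹ < n ⁻¹
    n⁻¹∙k⁻¹<n⁻¹ le = n<k (≲-trans (≲-cancelˡ {k} {k ∙ n}
      (≲-resp (sym (trans (∙-congʳ (⁻¹-anti-homo-∙ k n)) (//-rightDividesˡ k (n ⁻¹))))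
              (sym (⁻¹-anti-homo-∙ k n)) le))
      (x≲y⁻¹⇒x∙y≲y k≲n⁻¹))

  -- If `k ⁻¹ < n`, the previous lemma for `k ⁻¹` and `n` yields `n ⁻¹ ≲ k ⁻¹`, and
  -- `k ≲ n ⁻¹ ≲ k ⁻¹ ≲ n` is a contradiction.
  n<k≲n⁻¹⇒n≲k⁻¹ : ∀ {n k} → n < k → k ≲ n ⁻¹ → n ≲ k ⁻¹
  n<k≲n⁻¹⇒n≲k⁻¹ {n} {k} n<k k≲n⁻¹ = dne λ k⁻¹<n →
    n<k (≲-trans k≲n⁻¹ (≲-trans
      (n<k≲n⁻¹⇒k⁻¹≲n k⁻¹<n (≲-respʳ-≈ (sym (⁻¹-involutive k)) (<⇒≲ n<k)))
      (<⇒≲ k⁻¹<n)))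

  x≲x⁻¹∧y<x⇒y⁻¹<x : ∀ {x y} → x ≲ x ⁻¹ → y < x → y ⁻¹ < x
  x≲x⁻¹∧y<x⇒y⁻¹<x x≲x⁻¹ y<x x≲y⁻¹ = y<x (≲-trans x≲x⁻¹ (n<k≲n⁻¹⇒k⁻¹≲n y<x x≲y⁻¹))

  ≲-∙-closed : ∀ {n x y} → n ≲ n ⁻¹ → x ≲ n → y ≲ n → x ∙ y ≲ n
  ≲-∙-closed {n} {x} {y} n≲n⁻¹ x≲n y≲n with em {P = n ⁻¹ ≲ y ⁻¹}
  ... | yes n⁻¹≲y⁻¹ =
    ≲-trans (x≲y⁻¹⇒x∙y≲y (≲-trans x≲n (≲-trans n≲n⁻¹ n⁻¹≲y⁻¹))) y≲n
  ... | no y⁻¹<n⁻¹ = dne λ n<x∙y → [ p<y n<x∙y , y<p ]′ (≲-total y p)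
    where
    -- Neither comparison of `y` with `p` is possible if `n < x ∙ y`. From `p ≲ y` follows
    -- `n ⁻¹ ≲ y ⁻¹`, excluded here. From `y ≲ p` follows `x ≲ n ≲ p ⁻¹`, so `x ∙ p ≲ p ≲ n ⁻¹`; as
    -- `x ∙ p` is `(x ∙ y) ∙ n ⁻¹`, this gives `x ∙ y ≲ n`.
    p = y ∙ n ⁻¹

    y<p : y < p
    y<p p≲y = y⁻¹<n⁻¹ (≲-cancelˡ
      (≲-resp (∙-congʳ (sym (⁻¹-involutive y))) (sym (⁻¹-involutive y)) p≲y))

    p<y : n < x ∙ y → p < y
    p<y n<x∙y y≲p = n<x∙y (≲-cancel (≲-trans
      (≲-respˡ-≈ (sym (assoc x y (n ⁻¹))) (x≲y⁻¹⇒x∙y≲y (≲-trans x≲n n≲p⁻¹)))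
      (x≲y⇒x∙y⁻¹≲y⁻¹ y≲n)))
      where
      n≲p⁻¹ : n ≲ p ⁻¹
      n≲p⁻¹ = ≲-cancelˡ (≲-resp
        (sym (trans (∙-congʳ (⁻¹-involutive p)) (//-rightDividesˡ n y)))
        (sym (⁻¹-involutive p)) y≲p)

  -- If `y ≲ x ⁻¹`, then `x ∙ y ≲ x`; if `x ⁻¹ ≲ y`, then `(x ∙ y) ⁻¹ ≲ y ⁻¹`. This and its mirror
  -- image are the mixed cases of closure for `Cut upTo`.
  x≲n∧y⁻¹≲n⇒[x∙y]^±¹≲n : ∀ {n x y} → x ≲ n → y ⁻¹ ≲ n → x ∙ y ≲ n ⊎ (x ∙ y) ⁻¹ ≲ n
  x≲n∧y⁻¹≲n⇒[x∙y]^±¹≲n {n} {x} {y} x≲n y⁻¹≲n = dne λ ¬p →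
    let n<x∙y = ¬p ∘ inj₁ ; n<[x∙y]⁻¹ = ¬p ∘ inj₂ in
    [ (λ y≲x⁻¹ → n<x∙y (≲-trans (≲-cancelˡ
        (≲-respˡ-≈ (sym (\\-leftDividesʳ x y)) y≲x⁻¹)) x≲n))
    , (λ x⁻¹≲y → n<[x∙y]⁻¹ (≲-trans (≲-cancelˡ
        (≲-resp (sym (trans (∙-congˡ (⁻¹-anti-homo-∙ x y)) (\\-leftDividesʳ (y ⁻¹) (x ⁻¹))))
                (sym (⁻¹-involutive y)) x⁻¹≲y)) y⁻¹≲n))
    ]′ (≲-total y (x ⁻¹))

  x⁻¹≲n∧y≲n⇒[x∙y]^±¹≲n : ∀ {n x y} → x ⁻¹ ≲ n → y ≲ n → x ∙ y ≲ n ⊎ (x ∙ y) ⁻¹ ≲ n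
  x⁻¹≲n∧y≲n⇒[x∙y]^±¹≲n {n} {x} {y} x⁻¹≲n y≲n = dne λ ¬p →
    let n<x∙y = ¬p ∘ inj₁ ; n<[x∙y]⁻¹ = ¬p ∘ inj₂ in
    [ (λ x≲y⁻¹ → n<x∙y (≲-trans (≲-cancel
        (≲-respˡ-≈ (sym (//-rightDividesʳ y x)) x≲y⁻¹)) y≲n))
    , (λ y⁻¹≲x → n<[x∙y]⁻¹ (≲-trans (≲-cancel
        (≲-resp (sym (trans (∙-congʳ (⁻¹-anti-homo-∙ x y)) (//-rightDividesʳ (x ⁻¹) (y ⁻¹))))
                (sym (⁻¹-involutive x)) y⁻¹≲x)) x⁻¹≲n))
    ]′ (≲-total x (y ⁻¹))

  -- Cuts: the convex subgroups attached to `ε` and to o⁻-type elements.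

  data Side : Set where
    below upTo : Side

  -- For o⁻-type `n` these turn out to be everything strictly below the type-component of `n`, and
  -- everything up to and including it.
  Cut : Side → Carrier → Pred Carrier r
  Cut below n x = x ≲ n × x ⁻¹ ≲ n
  Cut upTo  n x = x ≲ n ⊎ x ⁻¹ ≲ n

  -- The point `ε`, whose cuts are trivial, separates the identity from all other elements even when
  -- no o⁻-type element exists.
  CutPoint : Pred Carrier (ℓ ⊔ r)
  CutPoint n = n ≈ ε ⊎ n < n ⁻¹

  CutPoint⇒x≲x⁻¹ : ∀ {n} → CutPoint n → n ≲ n ⁻¹
  CutPoint⇒x≲x⁻¹ (inj₁ n≈ε) = ≲-reflexive (trans n≈ε (trans (sym ε⁻¹≈ε) (⁻¹-cong (sym n≈ε))))
  CutPoint⇒x≲x⁻¹ (inj₂ n<n⁻¹) = <⇒≲ n<n⁻¹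

  CutPoint-^ : ∀ {n} z → CutPoint n → CutPoint (n ^ z)
  CutPoint-^ z (inj₁ n≈ε) = inj₁ (trans (^-congˡ z n≈ε) (ε^z≈ε z))
  CutPoint-^ {n} z (inj₂ n<n⁻¹) = inj₂ λ le → n<n⁻¹
    (≲-resp (trans (^-congˡ _ (sym (^-⁻¹-comm n z))) (^-inverseˡ _ z)) (^-inverseˡ n z)
            (^-mono (z ⁻¹) le))

  Cut-down : ∀ s {n x y} → y ≲ x → y ⁻¹ ≲ x ⁻¹ → Cut s n x → Cut s n y
  Cut-down below y≲x y⁻¹≲x⁻¹ (x≲n , x⁻¹≲n) = ≲-trans y≲x x≲n , ≲-trans y⁻¹≲x⁻¹ x⁻¹≲n
  Cut-down upTo  y≲x y⁻¹≲x⁻¹ = Sum.map (≲-trans y≲x) (≲-trans y⁻¹≲x⁻¹)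

  Cut-resp : ∀ s {n x y} → x ≈ y → Cut s n x → Cut s n y
  Cut-resp s x≈y = Cut-down s (≲-reflexive (sym x≈y)) (≲-reflexive (⁻¹-cong (sym x≈y)))

  Cut-respᵖ : ∀ s {m n x} → m ≈ n → Cut s m x → Cut s n x
  Cut-respᵖ below m≈n (x≲m , x⁻¹≲m) = ≲-respʳ-≈ m≈n x≲m , ≲-respʳ-≈ m≈n x⁻¹≲m
  Cut-respᵖ upTo  m≈n = Sum.map (≲-respʳ-≈ m≈n) (≲-respʳ-≈ m≈n)

  Cut-^ : ∀ s {n x} z → Cut s n x → Cut s (n ^ z) (x ^ z)
  Cut-^ below z (x≲n , x⁻¹≲n) =
    ^-mono z x≲n , ≲-respˡ-≈ (^-⁻¹-comm _ z) (^-mono z x⁻¹≲n)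
  Cut-^ upTo  z = Sum.map (^-mono z) (≲-respˡ-≈ (^-⁻¹-comm _ z) ∘ ^-mono z)

  Cut-⁻¹ : ∀ s {n x} → Cut s n x → Cut s n (x ⁻¹)
  Cut-⁻¹ below (x≲n , x⁻¹≲n) = x⁻¹≲n , ≲-respˡ-≈ (sym (⁻¹-involutive _)) x≲n
  Cut-⁻¹ upTo  = Sum.swap ∘ Sum.map₁ (≲-respˡ-≈ (sym (⁻¹-involutive _)))

  Cut-∙ : ∀ s {n x y} → CutPoint n → Cut s n x → Cut s n y → Cut s n (x ∙ y)
  Cut-∙ below {n} {x} {y} n∈ (x≲n , x⁻¹≲n) (y≲n , y⁻¹≲n) =
    ≲-∙-closed n≲n⁻¹ x≲n y≲n ,
    ≲-respˡ-≈ (sym (⁻¹-anti-homo-∙ x y)) (≲-∙-closed n≲n⁻¹ y⁻¹≲n x⁻¹≲n)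
    where n≲n⁻¹ = CutPoint⇒x≲x⁻¹ n∈
  Cut-∙ upTo n∈ (inj₁ x≲n) (inj₁ y≲n) = inj₁ (≲-∙-closed (CutPoint⇒x≲x⁻¹ n∈) x≲n y≲n)
  Cut-∙ upTo n∈ (inj₁ x≲n) (inj₂ y⁻¹≲n) = x≲n∧y⁻¹≲n⇒[x∙y]^±¹≲n x≲n y⁻¹≲n
  Cut-∙ upTo n∈ (inj₂ x⁻¹≲n) (inj₁ y≲n) = x⁻¹≲n∧y≲n⇒[x∙y]^±¹≲n x⁻¹≲n y≲n
  Cut-∙ upTo n∈ (inj₂ x⁻¹≲n) (inj₂ y⁻¹≲n) = inj₂ (≲-respˡ-≈ (sym (⁻¹-anti-homo-∙ _ _))
    (≲-∙-closed (CutPoint⇒x≲x⁻¹ n∈) y⁻¹≲n x⁻¹≲n))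

  -- For `upTo` with `x ⁻¹ ≲ n`, an outside `y < x` would satisfy `x ⁻¹ < y ≲ x`, hence
  -- `y ⁻¹ ≲ x ⁻¹ ≲ n`, and so lie inside.
  Cut-initial : ∀ s {n x y} → CutPoint n → Cut s n x → ¬ Cut s n y → x ≲ y
  Cut-initial below {n} {x} {y} n∈ (x≲n , _) y∉ = dne λ y<x →
    let y<n = λ n≲y → y<x (≲-trans x≲n n≲y) in
    y∉ (<⇒≲ y<n , <⇒≲ (x≲x⁻¹∧y<x⇒y⁻¹<x (CutPoint⇒x≲x⁻¹ n∈) y<n))
  Cut-initial upTo n∈ (inj₁ x≲n) y∉ = ≲-trans x≲n (<⇒≲ (y∉ ∘ inj₁))
  Cut-initial upTo {n} {x} {y} n∈ (inj₂ x⁻¹≲n) y∉ = dne λ y<x →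
    y∉ (inj₂ (≲-trans (n<k≲n⁻¹⇒k⁻¹≲n (λ y≲x⁻¹ → y∉ (inj₁ (≲-trans y≲x⁻¹ x⁻¹≲n)))
                        (≲-respʳ-≈ (sym (⁻¹-involutive x)) (<⇒≲ y<x)))
                      x⁻¹≲n))

  -- The total preorder defined by the cuts.

  infix 4 _⊑_ _⊏_ _≋_
  -- `x ⊏ y` is classically the negation of `y ⊑ x`, stated with a separating cut so that the cut is
  -- at hand.
  _⊑_ _⊏_ _≋_ : Rel Carrier (c ⊔ ℓ ⊔ r)
  x ⊑ y = ∀ s {n} → CutPoint n → Cut s n y → Cut s n x
  x ⊏ y = ∃₂ λ s n → CutPoint n × Cut s n x × ¬ Cut s n y
  x ≋ y = x ⊑ y × y ⊑ x

  ⊑-refl : ∀ {x} → x ⊑ x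
  ⊑-refl _ _ = id

  ⊑-trans : ∀ {x y z} → x ⊑ y → y ⊑ z → x ⊑ z
  ⊑-trans x⊑y y⊑z s n∈ = x⊑y s n∈ ∘ y⊑z s n∈

  ≈⇒⊑ : ∀ {x y} → x ≈ y → x ⊑ y
  ≈⇒⊑ x≈y s _ = Cut-resp s (sym x≈y)

  x⊑x⁻¹ : ∀ {x} → x ⊑ x ⁻¹
  x⊑x⁻¹ s _ = Cut-resp s (⁻¹-involutive _) ∘ Cut-⁻¹ s

  x⁻¹⊑x : ∀ {x} → x ⁻¹ ⊑ x
  x⁻¹⊑x s _ = Cut-⁻¹ s

  ⁻¹-cancel-⊑ : ∀ {x y} → x ⁻¹ ⊑ y ⁻¹ → x ⊑ y
  ⁻¹-cancel-⊑ x⁻¹⊑y⁻¹ = ⊑-trans x⊑x⁻¹ (⊑-trans x⁻¹⊑y⁻¹ x⁻¹⊑x)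

  ⊑-∙-closed : ∀ {x y z} → x ⊑ z → y ⊑ z → x ∙ y ⊑ z
  ⊑-∙-closed x⊑z y⊑z s n∈ z∈ = Cut-∙ s n∈ (x⊑z s n∈ z∈) (y⊑z s n∈ z∈)

  ⊑-//-closed : ∀ {x y z} → x ⊑ z → y ⊑ z → x ∙ y ⁻¹ ⊑ z
  ⊑-//-closed x⊑z y⊑z = ⊑-∙-closed x⊑z (⊑-trans x⁻¹⊑x y⊑z)

  ⊑-^-mono : ∀ {x y} z → x ⊑ y → x ^ z ⊑ y ^ z
  ⊑-^-mono {x} {y} z x⊑y s {n} n∈ y^z∈ =
    Cut-respᵖ s (^-inverseʳ n z) (Cut-^ s z (x⊑y s (CutPoint-^ (z ⁻¹) n∈)
      (Cut-resp s (^-inverseˡ y z) (Cut-^ s (z ⁻¹) y^z∈))))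

  ⊑ε⇒≈ε : ∀ {x y} → y ≈ ε → x ⊑ y → x ≈ ε
  ⊑ε⇒≈ε y≈ε x⊑y = ≲ε⇒≈ε (proj₁ (x⊑y below (inj₁ refl)
    (≲-reflexive y≈ε , ≲-reflexive (trans (⁻¹-cong y≈ε) ε⁻¹≈ε))))

  ⊏⇒⋣ : ∀ {x y} → x ⊏ y → ¬ y ⊑ x
  ⊏⇒⋣ (s , n , n∈ , x∈ , y∉) y⊑x = y∉ (y⊑x s n∈ x∈)

  ⋣⇒⊏ : ∀ {x y} → ¬ y ⊑ x → x ⊏ y
  ⋣⇒⊏ y⋢x = dne λ x⊄y → y⋢x λ s n∈ x∈ → dne λ y∉ → x⊄y (s , _ , n∈ , x∈ , y∉)

  ⊏⇒≲ : ∀ {x y} → x ⊏ y → x ≲ y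
  ⊏⇒≲ (s , n , n∈ , x∈ , y∉) = Cut-initial s n∈ x∈ y∉

  ⊑-⊏-trans : ∀ {x y z} → x ⊑ y → y ⊏ z → x ⊏ z
  ⊑-⊏-trans x⊑y (s , n , n∈ , y∈ , z∉) = s , n , n∈ , x⊑y s n∈ y∈ , z∉

  ⊏-⊑-trans : ∀ {x y z} → x ⊏ y → y ⊑ z → x ⊏ z
  ⊏-⊑-trans (s , n , n∈ , x∈ , y∉) y⊑z = s , n , n∈ , x∈ , y∉ ∘ y⊑z s n∈

  -- Cuts are nested, which makes `⊑` total: a second cut with `y` inside and `x` outside would give
  -- `y ≲ x` and `y ⁻¹ ≲ x ⁻¹`, putting `y` into the first cut.
  ⊏⇒⊑ : ∀ {x y} → x ⊏ y → x ⊑ y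
  ⊏⇒⊑ x⊏y@(s , n , n∈ , x∈ , y∉) s′ n′∈ y∈′ = dne λ x∉′ →
    let y⊏x = s′ , _ , n′∈ , y∈′ , x∉′ in
    y∉ (Cut-down s (⊏⇒≲ y⊏x) (⊏⇒≲ (⊏-⊑-trans (⊑-⊏-trans x⁻¹⊑x y⊏x) x⊑x⁻¹)) x∈)

  ⊑-total : ∀ x y → x ⊑ y ⊎ y ⊑ x
  ⊑-total x y with em {P = y ⊑ x}
  ... | yes y⊑x = inj₂ y⊑x
  ... | no  y⋢x = inj₁ (⊏⇒⊑ (⋣⇒⊏ y⋢x))

  ⊑-isTotalPreorder : IsTotalPreorder _≈_ _⊑_
  ⊑-isTotalPreorder = record
    { isPreorder = record
      { isEquivalence = isEquivalence ; reflexive = ≈⇒⊑ ; trans = ⊑-trans }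
    ; total = ⊑-total
    }

  <⇒⊑ : ∀ {x y} → x < y → x ⊑ y
  <⇒⊑ x<y = dne (x<y ∘ ⊏⇒≲ ∘ ⋣⇒⊏)

  x⊏y⇒y⊑y∙x : ∀ {x y} → x ⊏ y → y ⊑ y ∙ x
  x⊏y⇒y⊑y∙x {x} {y} x⊏y with ⊑-total x (y ∙ x)
  ... | inj₁ x⊑yx = ⊑-trans (≈⇒⊑ (sym (//-rightDividesʳ x y))) (⊑-//-closed ⊑-refl x⊑yx)
  ... | inj₂ yx⊑x = ⊥-elim (⊏⇒⋣ x⊏y
    (⊑-trans (≈⇒⊑ (sym (//-rightDividesʳ x y))) (⊑-//-closed yx⊑x ⊑-refl)))

  -- `x ⊏ y` gives `x ≲ y ⁻¹`, hence `y ∙ x ≲ y`; the other half is the same argument for `x ⁻¹` and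
  -- `y ∙ x`. It makes the induced quasi-orders well defined on cosets.
  x⊏y⇒y∙x∼y : ∀ {x y} → x ⊏ y → y ∙ x ∼ y
  x⊏y⇒y∙x∼y {x} {y} x⊏y =
    absorb x⊏y ,
    ≲-respˡ-≈ (//-rightDividesʳ x y) (absorb (⊑-⊏-trans x⁻¹⊑x (⊏-⊑-trans x⊏y (x⊏y⇒y⊑y∙x x⊏y))))
    where
    absorb : ∀ {x y} → x ⊏ y → y ∙ x ≲ y
    absorb x⊏y = x≲y⁻¹⇒y∙x≲y (⊏⇒≲ (⊏-⊑-trans x⊏y x⊑x⁻¹))

  -- A cut at `m` containing `x` has `x ≲ m`, which settles `upTo`. For `below` also `x ⁻¹ ≲ m`, so
  -- `m ≲ y` would give `x ⁻¹ ≲ x`; thus `y < m`, and then `y ⁻¹ < m`.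
  x<x⁻¹∧y≲x⇒y⊑x : ∀ {x y} → x < x ⁻¹ → y ≲ x → y ⊑ x
  x<x⁻¹∧y≲x⇒y⊑x x<x⁻¹ y≲x upTo m∈ x∈ =
    inj₁ (≲-trans y≲x ([ id , ≲-trans (<⇒≲ x<x⁻¹) ]′ x∈))
  x<x⁻¹∧y≲x⇒y⊑x x<x⁻¹ y≲x below m∈ (x≲m , x⁻¹≲m) =
    <⇒≲ y<m , <⇒≲ (x≲x⁻¹∧y<x⇒y⁻¹<x (CutPoint⇒x≲x⁻¹ m∈) y<m)
    where
    y<m = λ m≲y → x<x⁻¹ (≲-trans x⁻¹≲m (≲-trans m≲y y≲x))

  module _ {n} (n<n⁻¹ : n < n ⁻¹) where

    x⊑n⇔x∈upTo : ∀ {x} → x ⊑ n ⇔ Cut upTo n x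
    x⊑n⇔x∈upTo = mk⇔
      (λ x⊑n → x⊑n upTo (inj₂ n<n⁻¹) (inj₁ ≲-refl))
      [ x<x⁻¹∧y≲x⇒y⊑x n<n⁻¹ , ⊑-trans x⊑x⁻¹ ∘ x<x⁻¹∧y≲x⇒y⊑x n<n⁻¹ ]′

    x⊏n⇔x∈below : ∀ {x} → x ⊏ n ⇔ Cut below n x
    x⊏n⇔x∈below {x} = mk⇔
      (λ x⊏n → dne (to-below x⊏n (Equivalence.to x⊑n⇔x∈upTo (⊏⇒⊑ x⊏n))))
      (λ x∈ → below , n , inj₂ n<n⁻¹ , x∈ , n<n⁻¹ ∘ proj₂)
      where
      -- An `x ≲ n` outside `Cut below n` is itself o⁻-type and satisfies `n ≲ x`.
      n⊑ : ∀ {x} → x ≲ n → ¬ Cut below n x → n ⊑ x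
      n⊑ {x} x≲n x∉ = x<x⁻¹∧y≲x⇒y⊑x (λ x⁻¹≲x → x∉ (x≲n , ≲-trans x⁻¹≲x x≲n))
        (dne λ x<n → x∉ (x≲n , <⇒≲ (x≲x⁻¹∧y<x⇒y⁻¹<x (<⇒≲ n<n⁻¹) x<n)))
      to-below : x ⊏ n → Cut upTo n x → ¬ ¬ Cut below n x
      to-below x⊏n (inj₁ x≲n) x∉ = ⊏⇒⋣ x⊏n (n⊑ x≲n x∉)
      to-below x⊏n (inj₂ x⁻¹≲n) x∉ = ⊏⇒⋣ x⊏n
        (⊑-trans (n⊑ x⁻¹≲n (x∉ ∘ Cut-resp below (⁻¹-involutive x) ∘ Cut-⁻¹ below)) x⁻¹⊑x)

  -- Type-components are the classes of `≋`.

  open Types G R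

  O⁺⇒< : ∀ {x} → O⁺-type x → x ⁻¹ < x
  O⁺⇒< = ⋨⇒<

  V-type∧Cut⇒≲ : ∀ s {n x} → V-type x → Cut s n x → x ≲ n
  V-type∧Cut⇒≲ below _ = proj₁
  V-type∧Cut⇒≲ upTo (x≲x⁻¹ , _) = [ id , ≲-trans x≲x⁻¹ ]′

  V-type∧≲⇒Cut : ∀ s {n x} → V-type x → x ≲ n → Cut s n x
  V-type∧≲⇒Cut below (_ , x⁻¹≲x) x≲n = x≲n , ≲-trans x⁻¹≲x x≲n
  V-type∧≲⇒Cut upTo _ = inj₁

  -- A v-type element of `Cut upTo n` already lies in `Cut below n`, so it is strictly below an
  -- o⁻-type `n`.
  V-type∧≋⇒≮⁻¹ : ∀ {x n} → V-type x → x ≋ n → ¬ (n < n ⁻¹)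
  V-type∧≋⇒≮⁻¹ v (x⊑n , n⊑x) n<n⁻¹ =
    ⊏⇒⋣ (from (x⊏n⇔x∈below n<n⁻¹) (x∈below (to (x⊑n⇔x∈upTo n<n⁻¹) x⊑n))) n⊑x
    where
    open Equivalence
    x∈below : Cut upTo _ _ → Cut below _ _
    x∈below = V-type∧≲⇒Cut below v ∘ V-type∧Cut⇒≲ upTo v

  V-type-resp-≋ : ∀ {x y} → V-type x → x ≋ y → V-type y
  V-type-resp-≋ vx (x⊑y , y⊑x) =
    dne (V-type∧≋⇒≮⁻¹ vx (⊑-trans x⊑y x⊑x⁻¹ , ⊑-trans x⁻¹⊑x y⊑x) ∘ x⁻¹<x⇒x⁻¹<x⁻¹⁻¹) ,
    dne (V-type∧≋⇒≮⁻¹ vx (x⊑y , y⊑x))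

  -- The witness is the point of the cut separating `x` from `y`; it is not `ε`, because `x` lies
  -- below it and is not `ε`.
  V-type-separated : ∀ {x y} → V-type x → V-type y → ¬ x ≈ ε → x ⊏ y →
                     ∃[ n ] n < n ⁻¹ × x ≲ n × n < y
  V-type-separated vx vy x≉ε (s , n , inj₁ n≈ε , x∈ , _) =
    ⊥-elim (x≉ε (≲ε⇒≈ε (≲-respʳ-≈ n≈ε (V-type∧Cut⇒≲ s vx x∈))))
  V-type-separated vx vy x≉ε (s , n , inj₂ n<n⁻¹ , x∈ , y∉) =
    n , n<n⁻¹ , V-type∧Cut⇒≲ s vx x∈ , y∉ ∘ V-type∧≲⇒Cut s vy

  -- From `x ⁻¹ < y ≲ x` the inverses are `∼`-equivalent, and they are o⁻-type, where `≲` implies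
  -- `⊑`.
  O⁺∧O⁺⇒≋ : ∀ {x y} → x ⁻¹ < x → y ⁻¹ < y → y ≲ x → x ⁻¹ < y → x ≋ y
  O⁺∧O⁺⇒≋ {x} {y} x⁻¹<x y⁻¹<y y≲x x⁻¹<y =
    ⁻¹-cancel-⊑ (x<x⁻¹∧y≲x⇒y⊑x (x⁻¹<x⇒x⁻¹<x⁻¹⁻¹ y⁻¹<y) (n<k≲n⁻¹⇒n≲k⁻¹ x⁻¹<y y≲x⁻¹⁻¹)) ,
    ⁻¹-cancel-⊑ (x<x⁻¹∧y≲x⇒y⊑x (x⁻¹<x⇒x⁻¹<x⁻¹⁻¹ x⁻¹<x) (n<k≲n⁻¹⇒k⁻¹≲n x⁻¹<y y≲x⁻¹⁻¹))
    where y≲x⁻¹⁻¹ = ≲-respʳ-≈ (sym (⁻¹-involutive x)) y≲x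

  -- The inverse of the larger element is o⁻-type, so it cannot lie between the two and must be
  -- strictly below the smaller one.
  T⁺⇒≋ : ∀ {x y} → O⁺-type x → T⁺ x y → x ≋ y
  T⁺⇒≋ {x} {y} x⁺ (y⁺ , between) with ≲-total y x
  ... | inj₁ y≲x = O⁺∧O⁺⇒≋ (O⁺⇒< x⁺) (O⁺⇒< y⁺) y≲x λ y≲x⁻¹ →
    O⁺⇒< (between (inj₂ (y≲x⁻¹ , proj₁ x⁺))) (≲-respʳ-≈ (sym (⁻¹-involutive x)) (proj₁ x⁺))
  ... | inj₂ x≲y = swap (O⁺∧O⁺⇒≋ (O⁺⇒< y⁺) (O⁺⇒< x⁺) x≲y λ x≲y⁻¹ →
    O⁺⇒< (between (inj₁ (x≲y⁻¹ , proj₁ y⁺))) (≲-respʳ-≈ (sym (⁻¹-involutive y)) (proj₁ y⁺)))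

  T⁺∪T⁻⇒≋ : ∀ {x y} → O⁺-type x → T⁺ x y ⊎ T⁻ x y → x ≋ y
  T⁺∪T⁻⇒≋ x⁺ (inj₁ y∈) = T⁺⇒≋ x⁺ y∈
  T⁺∪T⁻⇒≋ x⁺ (inj₂ y⁻¹∈) with x⊑y⁻¹ , y⁻¹⊑x ← T⁺⇒≋ x⁺ y⁻¹∈ =
    ⊑-trans x⊑y⁻¹ x⁻¹⊑x , ⊑-trans x⊑x⁻¹ y⁻¹⊑x

  O⁻⇒O⁺⁻¹ : ∀ {x} → O⁻-type x → O⁺-type (x ⁻¹)
  O⁻⇒O⁺⁻¹ = <⇒⋨ ∘ x<x⁻¹⇒x⁻¹⁻¹<x⁻¹ ∘ ⋨⇒<

  ≋⇒T⁺ : ∀ {x y} → x ⁻¹ < x → y ⁻¹ ≲ x ⁻¹ → x ⁻¹ < y → T⁺ x y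
  ≋⇒T⁺ {x} {y} x⁻¹<x y⁻¹≲x⁻¹ x⁻¹<y = <⇒⋨ (λ y≲y⁻¹ → x⁻¹<y (≲-trans y≲y⁻¹ y⁻¹≲x⁻¹)) ,
    λ { (inj₁ (x≲k , k≲y)) → O⁺ (λ k≲y⁻¹ → x⁻¹<x (≲-trans x≲k (≲-trans k≲y⁻¹ y⁻¹≲x⁻¹))) k≲y
      ; (inj₂ (y≲k , k≲x)) → O⁺ (λ k≲x⁻¹ → x⁻¹<y (≲-trans y≲k k≲x⁻¹)) k≲x }
    where
    -- On this interval `k ⁻¹ ≲ x ⁻¹ < k`.
    O⁺ : ∀ {x k} → x ⁻¹ < k → k ≲ x → O⁺-type k
    O⁺ x⁻¹<k k≲x = <⇒⋨ λ k≲k⁻¹ → x⁻¹<k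
      (≲-trans k≲k⁻¹ (n<k≲n⁻¹⇒k⁻¹≲n x⁻¹<k (≲-respʳ-≈ (sym (⁻¹-involutive _)) k≲x)))

  -- `y` lies in `Cut upTo (x ⁻¹)` but not in `Cut below (x ⁻¹)`, so exactly one of `y` and `y ⁻¹`
  -- is `≲ x ⁻¹`; which one decides between `T⁻` and `T⁺`.
  ≋⇒T⁺∪T⁻ : ∀ {x y} → O⁺-type x → x ≋ y → T⁺ x y ⊎ T⁻ x y
  ≋⇒T⁺∪T⁻ {x} {y} x⁺ (x⊑y , y⊑x) =
    [ (λ y≲x⁻¹ → inj₂ (≋⇒T⁺ (O⁺⇒< x⁺) (≲-respˡ-≈ (sym (⁻¹-involutive y)) y≲x⁻¹)
        λ y⁻¹≲x⁻¹ → y∉below (y≲x⁻¹ , y⁻¹≲x⁻¹)))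
    , (λ y⁻¹≲x⁻¹ → inj₁ (≋⇒T⁺ (O⁺⇒< x⁺) y⁻¹≲x⁻¹ λ y≲x⁻¹ → y∉below (y≲x⁻¹ , y⁻¹≲x⁻¹)))
    ]′ (to (x⊑n⇔x∈upTo x⁻) (⊑-trans y⊑x x⊑x⁻¹))
    where
    open Equivalence
    x⁻ : x ⁻¹ < x ⁻¹ ⁻¹
    x⁻ = x⁻¹<x⇒x⁻¹<x⁻¹⁻¹ (O⁺⇒< x⁺)
    y∉below : ¬ Cut below (x ⁻¹) y
    y∉below y∈ = ⊏⇒⋣ (from (x⊏n⇔x∈below x⁻) y∈) (⊑-trans x⁻¹⊑x x⊑y)

  -- `k ⁻¹` is a cut point with `x ≲ k ⁻¹`, since `k ⁻¹ < x` would force `k < x`. By `y ⊑ x` also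
  -- `y ≲ k ⁻¹`, so `k ≲ y` would give `k ≲ k ⁻¹`.
  V-type∧⊑⇒no-O⁺-between : ∀ {x y k} → V-type x → V-type y → y ⊑ x →
                            O⁺-type k → x ≲ k → ¬ k ≲ y
  V-type∧⊑⇒no-O⁺-between {x} {y} {k} vx vy y⊑x k⁺ x≲k k≲y = O⁺⇒< k⁺ (≲-trans k≲y
    (V-type∧Cut⇒≲ upTo vy (y⊑x upTo (inj₂ (x⁻¹<x⇒x⁻¹<x⁻¹⁻¹ (O⁺⇒< k⁺))) (inj₁ x≲k⁻¹))))
    where
    x≲k⁻¹ = dne λ k⁻¹<x → x≲x⁻¹∧y<x⇒y⁻¹<x (proj₁ vx) k⁻¹<x
      (≲-respʳ-≈ (sym (⁻¹-involutive k)) x≲k)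

  T⇒≋ : ∀ {x y} → T x y → x ≋ y
  T⇒≋ (T-1 x≈ε y≈ε) = ≈⇒⊑ (trans x≈ε (sym y≈ε)) , ≈⇒⊑ (trans y≈ε (sym x≈ε))
  T⇒≋ (T-v x≉ε vx vy y≉ε none) =
    -- A separating o⁻-type `n` would put the o⁺-type element `n ⁻¹` between `y` and `x`.
    dne (λ x⋢y → let n , n<n⁻¹ , y≲n , n<x = V-type-separated vy vx y≉ε (⋣⇒⊏ x⋢y) in
      none (n ⁻¹ , inj₁ (≲-trans y≲n (<⇒≲ n<n⁻¹) , <⇒≲ (x≲x⁻¹∧y<x⇒y⁻¹<x (proj₁ vx) n<x)) ,
            <⇒⋨ (x<x⁻¹⇒x⁻¹⁻¹<x⁻¹ n<n⁻¹))) ,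
    dne (λ y⋢x → let n , n<n⁻¹ , x≲n , n<y = V-type-separated vx vy x≉ε (⋣⇒⊏ y⋢x) in
      none (n ⁻¹ , inj₂ (≲-trans x≲n (<⇒≲ n<n⁻¹) , <⇒≲ (x≲x⁻¹∧y<x⇒y⁻¹<x (proj₁ vy) n<y)) ,
            <⇒⋨ (x<x⁻¹⇒x⁻¹⁻¹<x⁻¹ n<n⁻¹)))
  T⇒≋ (T-o⁺ x⁺ y∈) = T⁺∪T⁻⇒≋ x⁺ y∈
  T⇒≋ (T-o⁻ x⁻ y∈) with x⁻¹⊑y , y⊑x⁻¹ ← T⁺∪T⁻⇒≋ (O⁻⇒O⁺⁻¹ x⁻) y∈ =
    ⊑-trans x⊑x⁻¹ x⁻¹⊑y , ⊑-trans y⊑x⁻¹ x⁻¹⊑x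

  ≋⇒T : ∀ {x y} → x ≋ y → T x y
  ≋⇒T {x} {y} x≋y@(x⊑y , y⊑x) with em {P = x ≈ ε} | em {P = x ≲ x ⁻¹} | em {P = x ⁻¹ ≲ x}
  ... | yes x≈ε | _ | _ = T-1 x≈ε (⊑ε⇒≈ε x≈ε y⊑x)
  ... | no x≉ε | yes x≲x⁻¹ | yes x⁻¹≲x =
    T-v x≉ε vx vy (λ y≈ε → x≉ε (⊑ε⇒≈ε y≈ε x⊑y))
      λ { (k , inj₁ (y≲k , k≲x) , k⁺) → V-type∧⊑⇒no-O⁺-between vy vx x⊑y k⁺ y≲k k≲x
        ; (k , inj₂ (x≲k , k≲y) , k⁺) → V-type∧⊑⇒no-O⁺-between vx vy y⊑x k⁺ x≲k k≲y }
    where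
    vx = x≲x⁻¹ , x⁻¹≲x
    vy = V-type-resp-≋ vx x≋y
  ... | no x≉ε | no x⁻¹<x | _ = T-o⁺ (<⇒⋨ x⁻¹<x) (≋⇒T⁺∪T⁻ (<⇒⋨ x⁻¹<x) x≋y)
  ... | no x≉ε | yes _ | no x<x⁻¹ = T-o⁻ (<⇒⋨ x<x⁻¹)
    (≋⇒T⁺∪T⁻ (O⁻⇒O⁺⁻¹ (<⇒⋨ x<x⁻¹)) (⊑-trans x⁻¹⊑x x⊑y , ⊑-trans y⊑x x⊑x⁻¹))

  ≋⇔T≐T : ∀ {x y} → x ≋ y ⇔ T x ≐ T y
  ≋⇔T≐T {x} {y} = mk⇔ to′ from′
    where
    T-⊆ : ∀ {x y} → y ≋ x → T x ⊆ T y
    T-⊆ (y⊑x , x⊑y) z∈ with x⊑z , z⊑x ← T⇒≋ z∈ = ≋⇒T (⊑-trans y⊑x x⊑z , ⊑-trans z⊑x x⊑y)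

    to′ : x ≋ y → T x ≐ T y
    to′ x≋y = T-⊆ (swap x≋y) , T-⊆ x≋y

    from′ : T x ≐ T y → x ≋ y
    from′ (_ , Ty⊆Tx) = T⇒≋ (Ty⊆Tx (≋⇒T (⊑-refl , ⊑-refl)))

  ⊑⇔≤ᵀ : ∀ {x y} → x ⊑ y ⇔ x ≤ᵀ y
  ⊑⇔≤ᵀ {x} {y} = mk⇔ to′ from′
    where
    open Equivalence
    to′ : x ⊑ y → x ≤ᵀ y
    to′ x⊑y with em {P = y ⊑ x}
    ... | yes y⊑x = inj₁ (to ≋⇔T≐T (x⊑y , y⊑x))
    ... | no y⋢x = inj₂ λ s∈ t∈ →
      ⊏⇒≲ (⊏-⊑-trans (⊑-⊏-trans (proj₂ (T⇒≋ s∈)) (⋣⇒⊏ y⋢x)) (proj₁ (T⇒≋ t∈)))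

    from′ : x ≤ᵀ y → x ⊑ y
    from′ (inj₁ T≐T) = proj₁ (from ≋⇔T≐T T≐T)
    -- Components are closed under inversion, so both `x ≲ y` and `x ⁻¹ ≲ y ⁻¹` are available.
    from′ (inj₂ T≲T) s n∈ y∈ = Cut-down s (T≲T (≋⇒T ≋-refl) (≋⇒T ≋-refl))
                                          (T≲T (≋⇒T ≋-⁻¹) (≋⇒T ≋-⁻¹)) y∈
      where
      ≋-refl : ∀ {x} → x ≋ x
      ≋-refl = ⊑-refl , ⊑-refl
      ≋-⁻¹ : ∀ {x} → x ≋ x ⁻¹
      ≋-⁻¹ = x⊑x⁻¹ , x⁻¹⊑x

-- Valuations read through a preorder.

record IsOrderedBy {G : Group c ℓ} {Γ : TotalOrder γ₁ γ₂ γ₃} (V : Valuation G Γ)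
                   (R : Rel (Group.Carrier G) r) : Set (c ⊔ ℓ ⊔ γ₁ ⊔ γ₂ ⊔ γ₃ ⊔ r) where
  open Group G
  open Valuation V
  open TotalOrder (withTop Γ) using (module Eq)
  private
    module Γ = TotalOrder Γ

    infix 4 _⊑_
    _⊑_ = R
  field
    -- Later arguments reach the valuation through these three fields and replace values by
    -- representatives, without unfolding `Γ`.
    v-≤⇔  : ∀ {x y} → v x Γ⁺.≤ v y ⇔ y ⊑ x
    rep   : Γ.Carrier → Carrier
    v-rep : ∀ γ → v (rep γ) Γ⁺.≈ [ γ ]

  open Equivalence

  v-≈⇔ : ∀ {x y} → v x Γ⁺.≈ v y ⇔ (x ⊑ y × y ⊑ x)
  v-≈⇔ = mk⇔
    (λ eq → to v-≤⇔ (Γ⁺.reflexive (Eq.sym eq)) , to v-≤⇔ (Γ⁺.reflexive eq))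
    (λ (x⊑y , y⊑x) → Γ⁺.antisym (from v-≤⇔ y⊑x) (from v-≤⇔ x⊑y))

  v-<⇔ : ∀ {x y} → v x Γ⁺.< v y ⇔ (¬ x ⊑ y)
  v-<⇔ {x} {y} = mk⇔
    (λ (le , ≉) x⊑y → ≉ (from v-≈⇔ (x⊑y , to v-≤⇔ le)))
    (λ x⋢y → [ id , ⊥-elim ∘ x⋢y ∘ to v-≤⇔ ]′ (Γ⁺.total (v x) (v y)) , x⋢y ∘ proj₁ ∘ to v-≈⇔)

  v-onto : ∀ γ → ∃[ x ] v x Γ⁺.≈ γ
  v-onto ⊤⁺    = ε , from v-∞ refl
  v-onto [ γ ] = rep γ , v-rep γ

  rep≉ε : ∀ γ → ¬ rep γ ≈ ε
  rep≉ε γ rep≈ε with () ← Eq.trans (Eq.sym (v-rep γ)) (from v-∞ rep≈ε)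

  finite : ∀ {x} → ¬ x ≈ ε → ∃[ γ ] v x Γ⁺.≈ [ γ ]
  finite {x} x≉ε = finite⁺ (v x) (x≉ε ∘ to v-∞)
    where
    finite⁺ : ∀ γ⁺ → ¬ γ⁺ Γ⁺.≈ ⊤⁺ → ∃[ γ ] γ⁺ Γ⁺.≈ [ γ ]
    finite⁺ ⊤⁺    ⊤≉⊤ = ⊥-elim (⊤≉⊤ Eq.refl)
    finite⁺ [ γ ] _   = γ , Eq.refl

  [γ]≤v⇔ : ∀ γ {x} → [ γ ] Γ⁺.≤ v x ⇔ x ⊑ rep γ
  [γ]≤v⇔ γ = mk⇔
    (λ le → to v-≤⇔ (Γ⁺.trans (Γ⁺.reflexive (v-rep γ)) le))
    (λ le → Γ⁺.trans (Γ⁺.reflexive (Eq.sym (v-rep γ))) (from v-≤⇔ le))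

  v≈[γ]⇔ : ∀ γ {x} → v x Γ⁺.≈ [ γ ] ⇔ (x ⊑ rep γ × rep γ ⊑ x)
  v≈[γ]⇔ γ = mk⇔
    (λ eq → to v-≈⇔ (Eq.trans eq (Eq.sym (v-rep γ))))
    (λ eq → Eq.trans (from v-≈⇔ eq) (v-rep γ))

  [γ]<v⇔ : ∀ γ {x} → [ γ ] Γ⁺.< v x ⇔ (¬ rep γ ⊑ x)
  [γ]<v⇔ γ {x} = mk⇔
    (λ (le , ≉) γ⊑x → ≉ (Eq.sym (from (v≈[γ]⇔ γ) (to ([γ]≤v⇔ γ) le , γ⊑x))))
    (λ γ⋢x → [ id , ⊥-elim ∘ γ⋢x ∘ to v-≤⇔ ∘ ≤-resp ]′ (Γ⁺.total [ γ ] (v x)) ,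
              γ⋢x ∘ proj₂ ∘ to (v≈[γ]⇔ γ) ∘ Eq.sym)
    where
    ≤-resp : v x Γ⁺.≤ [ γ ] → v x Γ⁺.≤ v (rep γ)
    ≤-resp le = Γ⁺.trans le (Γ⁺.reflexive (Eq.sym (v-rep γ)))

  ≤⇔ : ∀ {γ δ} → γ Γ.≤ δ ⇔ rep δ ⊑ rep γ
  ≤⇔ {γ} {δ} = mk⇔
    (λ γ≤δ → to ([γ]≤v⇔ γ) (Γ⁺.trans SupNonStrict.[ γ≤δ ] (Γ⁺.reflexive (Eq.sym (v-rep δ)))))
    (λ le → SupNonStrict.[≤]-injective Γ._≤_
      (Γ⁺.trans (from ([γ]≤v⇔ γ) le) (Γ⁺.reflexive (v-rep δ))))

-- The valuation of a conjugation-invariant total preorder.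

module PreorderValuation
  (em : ∀ {a} → ExcludedMiddle a) (K : Group c ℓ)
  (R : Rel (Group.Carrier K) r) (isTotalPreorder : IsTotalPreorder (Group._≈_ K) R)
  (R-ε⇒≈ε : ∀ {x y} → Group._≈_ K y (Group.ε K) → R x y → Group._≈_ K x (Group.ε K))
  (R-//-closed : ∀ {x y z} → R x z → R y z → R (Group._//_ K x y) z)
  (R-^-mono : ∀ {x y} z → R x y → R (Conjugation._^_ K x z) (Conjugation._^_ K y z)) where

  open Group K
  open Conjugation K
  open ConjugationProperties K
  open IsTotalPreorder isTotalPreorder
    using (≲-respˡ-≈; ≲-respʳ-≈)
    renaming (refl to ⊑-refl; reflexive to ⊑-reflexive; trans to ⊑-trans; total to ⊑-total)

  private
    infix 4 _⊑_
    _⊑_ = R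

    ε⊑ : ∀ {x y} → x ≈ ε → x ⊑ y
    ε⊑ {x} {y} x≈ε = ≲-respˡ-≈ (trans (inverseʳ y) (sym x≈ε)) (R-//-closed ⊑-refl ⊑-refl)

  -- No quotient is formed: finite values are the nontrivial elements, with equivalence under `R` as
  -- their equality.
  Γ : TotalOrder (c ⊔ ℓ) r r
  Γ = record
    { Carrier = ∃[ x ] ¬ x ≈ ε
    ; _≈_ = λ (x , _) (y , _) → x ⊑ y × y ⊑ x
    ; _≤_ = λ (x , _) (y , _) → y ⊑ x
    ; isTotalOrder = record
      { isPartialOrder = record
        { isPreorder = record
          { isEquivalence = record
            { refl  = ⊑-refl , ⊑-refl
            ; sym   = swap
            ; trans = λ (x⊑y , y⊑x) (y⊑z , z⊑y) → ⊑-trans x⊑y y⊑z , ⊑-trans z⊑y y⊑x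
            }
          ; reflexive = proj₂
          ; trans = λ y⊑x z⊑y → ⊑-trans z⊑y y⊑x
          }
        ; antisym = λ y⊑x x⊑y → x⊑y , y⊑x
        }
      ; total = λ (x , _) (y , _) → ⊑-total y x
      }
    }

  open WithTop Γ using (_≤_)
    renaming (_≈_ to _≈⁺_; trans to ≤-trans; antisym to ≤-antisym; module Eq to ≈⁺)
  open Min (withTop Γ) using (x⊓y≤x; x⊓y≤y)
  private module Γ = TotalOrder Γ

  -- The decision is an argument so that proofs about `v` can split on it.
  value : ∀ x → Dec (x ≈ ε) → Γ.Carrier ⁺
  value x (yes _)   = ⊤⁺
  value x (no x≉ε) = [ x , x≉ε ]

  v : Carrier → Γ.Carrier ⁺
  v x = value x em

  v-≤⇔ : ∀ {x y} → v x ≤ v y ⇔ y ⊑ x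
  v-≤⇔ {x} {y} = value-≤⇔ em em
    where
    value-≤⇔ : (x? : Dec (x ≈ ε)) (y? : Dec (y ≈ ε)) → value x x? ≤ value y y? ⇔ y ⊑ x
    value-≤⇔ x? (yes y≈ε) = mk⇔ (λ _ → ε⊑ y≈ε) (λ _ → _ SupNonStrict.≤⊤⁺)
    value-≤⇔ (yes x≈ε) (no y≉ε) = mk⇔ (λ ()) (⊥-elim ∘ y≉ε ∘ R-ε⇒≈ε x≈ε)
    value-≤⇔ (no _) (no _) = mk⇔ (λ { SupNonStrict.[ le ] → le }) SupNonStrict.[_]

  v-∞⇔ : ∀ {x} → v x ≈⁺ ⊤⁺ ⇔ x ≈ ε
  v-∞⇔ {x} = value-∞⇔ em
    where
    value-∞⇔ : (x? : Dec (x ≈ ε)) → value x x? ≈⁺ ⊤⁺ ⇔ x ≈ ε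
    value-∞⇔ (yes x≈ε) = mk⇔ (λ _ → x≈ε) (λ _ → ≈⁺.refl)
    value-∞⇔ (no x≉ε)  = mk⇔ (λ ()) (⊥-elim ∘ x≉ε)

  v-proj₁ : ∀ γ → v (proj₁ γ) ≈⁺ [ γ ]
  v-proj₁ (x , x≉ε) = value-[] em
    where
    value-[] : (x? : Dec (x ≈ ε)) → value x x? ≈⁺ [ x , x≉ε ]
    value-[] (yes x≈ε) = ⊥-elim (x≉ε x≈ε)
    value-[] (no _)    = SupEquality.[ ⊑-refl , ⊑-refl ]

  valuation : Valuation K Γ
  valuation = record
    { v      = v
    ; v-cong = λ x≈y → ≤-antisym (from v-≤⇔ (⊑-reflexive (sym x≈y))) (from v-≤⇔ (⊑-reflexive x≈y))
    ; v-∞    = v-∞⇔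
    ; v-min  = λ x y → [ (λ x⊑y → ≤-trans (x⊓y≤y (v x) (v y)) (from v-≤⇔ (R-//-closed x⊑y ⊑-refl)))
                       , (λ y⊑x → ≤-trans (x⊓y≤x (v x) (v y)) (from v-≤⇔ (R-//-closed ⊑-refl y⊑x)))
                       ]′ (⊑-total x y)
    ; v-conj = λ x y z → mk⇔
        (from v-≤⇔ ∘ R-^-mono z ∘ to v-≤⇔)
        (from v-≤⇔ ∘ ≲-respˡ-≈ (^-inverseˡ y z) ∘ ≲-respʳ-≈ (^-inverseˡ x z)
          ∘ R-^-mono (z ⁻¹) ∘ to v-≤⇔)
    }
    where open Equivalence

  isOrderedBy : IsOrderedBy valuation R
  isOrderedBy = record { v-≤⇔ = v-≤⇔ ; rep = proj₁ ; v-rep = v-proj₁ }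

-- Valuational quasi-orders and transport of the laws.

module _ {G : Group c ℓ} {_≲_ : Rel (Group.Carrier G) r} where
  open Group G
  open GroupProperties G using (ε⁻¹≈ε; ⁻¹-involutive)

  -- With `z ≲ z ⁻¹` for every `z`, `≲-∙-closed` applies to every bound, so `≲` itself is a preorder
  -- of the kind that yields a valuation.
  isValuational : (∀ {a} → ExcludedMiddle a) → CQuasiOrderLaws G _≲_ →
                  (∀ x → x ≲ (x ⁻¹)) → IsValuational G _≲_
  isValuational em laws x≲x⁻¹ = record
    { isCQuasiOrder = toCQuasiOrder em laws
    ; Γ             = Γ
    ; valuation     = valuation
    ; C⇔            = mk⇔ (from v-<⇔) (to v-<⇔)
    }
    where
    open Equivalence
    open CQuasiOrderLaws laws
    open CQuasiOrderProperties em laws using (≲-∙-closed; ≲-trans; ≲-respʳ-≈)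
    open module P = PreorderValuation em G _≲_ isTotalPreorder
      (λ y≈ε x≲y → ≲ε⇒≈ε (≲-respʳ-≈ y≈ε x≲y))
      (λ {_} {y} {z} x≲z y≲z → ≲-∙-closed (x≲x⁻¹ z) x≲z
        (≲-trans (≲-respʳ-≈ (⁻¹-involutive y) (x≲x⁻¹ (y ⁻¹))) y≲z))
      ^-mono
      using (Γ; valuation)
    open IsOrderedBy P.isOrderedBy using (v-<⇔)

  -- `C x (x ⁻¹) ε` would mean `v x < v (x ⁻¹)`, but `v-min` gives `v (x ⁻¹) ≤ v x`.
  IsValuational⇒x≲x⁻¹ : IsValuational G _≲_ → ∀ x → x ≲ (x ⁻¹)
  IsValuational⇒x≲x⁻¹ isVal x = from ≲⇔¬C λ Cxx⁻¹ε →
    let lt , ≉ = to C⇔ Cxx⁻¹ε in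
    ≉ (Γ⁺.antisym lt (Γ⁺.trans (Γ⁺.reflexive (v-cong (x∙ε⁻¹≈x (x ⁻¹))))
        (Γ⁺.trans v⁻¹≤v (Γ⁺.reflexive (v-cong (sym (x∙ε⁻¹≈x x)))))))
    where
    open Equivalence
    open IsValuational isVal
    open IsCQuasiOrder isCQuasiOrder using (≲⇔¬C)
    open Valuation valuation
    open Min (withTop Γ) using (⊓-glb)
    x∙ε⁻¹≈x : ∀ x → x ∙ ε ⁻¹ ≈ x
    x∙ε⁻¹≈x x = trans (∙-congˡ ε⁻¹≈ε) (identityʳ x)
    v⁻¹≤v : v (x ⁻¹) Γ⁺.≤ v x
    v⁻¹≤v = Γ⁺.trans
      (⊓-glb (Γ⁺.trans (_ SupNonStrict.≤⊤⁺) (Γ⁺.reflexive (Γ⁺.Eq.sym (from v-∞ refl)))) Γ⁺.refl)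
      (Γ⁺.trans (v-min ε (x ⁻¹))
        (Γ⁺.reflexive (v-cong (trans (identityˡ _) (⁻¹-involutive x)))))

  CQuasiOrderLaws-⇔ : ∀ {s} {_≲′_ : Rel Carrier s} → (∀ x y → (x ≲′ y) ⇔ (x ≲ y)) →
                      CQuasiOrderLaws G _≲_ → CQuasiOrderLaws G _≲′_
  CQuasiOrderLaws-⇔ {_≲′_ = _≲′_} ≲′⇔≲ laws = record
    { isTotalPreorder = record
      { isPreorder = record
        { isEquivalence = isEquivalence
        ; reflexive     = from (≲′⇔≲ _ _) ∘ ≲.reflexive
        ; trans         = λ p q → from (≲′⇔≲ _ _) (≲.trans (to (≲′⇔≲ _ _) p) (to (≲′⇔≲ _ _) q))
        }
      ; total = λ x y → Sum.map (from (≲′⇔≲ _ _)) (from (≲′⇔≲ _ _)) (≲.total x y)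
      }
    ; ≲ε⇒≈ε    = ≲ε⇒≈ε ∘ to (≲′⇔≲ _ _)
    ; ^-mono   = λ z → from (≲′⇔≲ _ _) ∘ ^-mono z ∘ to (≲′⇔≲ _ _)
    ; ≲-cancel = from (≲′⇔≲ _ _) ∘ ≲-cancel ∘ to (≲′⇔≲ _ _)
    }
    where
    open Equivalence
    open CQuasiOrderLaws laws
    module ≲ = IsTotalPreorder isTotalPreorder

-- The type-valuation and its strictly convex subgroups.

module TypeValuation (em : ∀ {a} → ExcludedMiddle a) {G : Group c ℓ}
                     {R : Rel (Group.Carrier G) r} (laws : CQuasiOrderLaws G R)
                     {Γ : TotalOrder (c ⊔ ℓ) (c ⊔ ℓ ⊔ r) (c ⊔ ℓ ⊔ r)} (V : Valuation G Γ)
                     (V-⊑ : IsOrderedBy V (CQuasiOrderProperties._⊑_ em laws)) where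
  open Group G
  open GroupProperties G
  open Conjugation G
  open ConjugationProperties G
  open CQuasiOrderLaws laws
  open CQuasiOrderProperties em laws
  open QuasiOrder R using (_∼_; StrictlyConvex)
  open Types G R using (IsTypeValuation; V-type)
  open IsOrderedBy V-⊑
  open ResidueGroups V
  open StrictOrder Γ renaming (_<_ to _<ᵞ_)
  open Equivalence
  private
    module Γ = TotalOrder Γ

    dne : ∀ {a} {A : Set a} → ¬ ¬ A → A
    dne = em⇒dne em

  isTypeValuation : IsTypeValuation V
  isTypeValuation = record
    { v-onto = v-onto
    ; v-≈    = mk⇔ (to ≋⇔T≐T ∘ to v-≈⇔) (from v-≈⇔ ∘ from ≋⇔T≐T)
    ; v-≤    = mk⇔ (to ⊑⇔≤ᵀ ∘ to v-≤⇔) (from v-≤⇔ ∘ from ⊑⇔≤ᵀ)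
    }

  ∈G>⇔ : ∀ γ {x} → x ∈ G> γ ⇔ x ⊏ rep γ
  ∈G>⇔ γ = mk⇔ (⋣⇒⊏ ∘ to ([γ]<v⇔ γ)) (from ([γ]<v⇔ γ) ∘ ⊏⇒⋣)

  G≥-strictlyConvex : ∀ γ → StrictlyConvex (G≥ γ)
  G≥-strictlyConvex γ _ t∈ _ x⋨t =
    from ([γ]≤v⇔ γ) (⊑-trans (<⇒⊑ (⋨⇒< x⋨t)) (to ([γ]≤v⇔ γ) t∈))

  G>-strictlyConvex : ∀ γ → StrictlyConvex (G> γ)
  G>-strictlyConvex γ _ t∈ _ x⋨t =
    from (∈G>⇔ γ) (⊑-⊏-trans (<⇒⊑ (⋨⇒< x⋨t)) (to (∈G>⇔ γ) t∈))

  -- The residue at a value.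

  module _ (γ : Γ.Carrier) where
    open IsSubgroup (G>-isSubgroup γ)
      renaming (resp to N-resp; ε-closed to ε∈N; ⁻¹-closed to N-⁻¹)
    open IsNormalSubgroupOf (G>-isNormalSubgroupOf-G≥ γ)
      using () renaming (conj-closed to N-^)
    open IsSubgroup (G≥-isSubgroup γ)
      using () renaming (∙-closed to K-∙; ⁻¹-closed to K-⁻¹)
    private
      module H = Group (H γ)
      module HP = GroupProperties (H γ)
      N = G> γ
      K = G≥ γ

      infix 4 _≲ᴴ_
      _≲ᴴ_ : Rel H.Carrier _
      _≲ᴴ_ = Residue R γ

    ∉N⇒γ⊑ : ∀ {x} → x ∉ N → rep γ ⊑ x
    ∉N⇒γ⊑ x∉ = dne (x∉ ∘ from (∈G>⇔ γ) ∘ ⋣⇒⊏)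

    ∈N⇒≈ε : ∀ {x} → proj₁ x ∈ N → x H.≈ H.ε
    ∈N⇒≈ε x∈ = N-resp (sym (identityʳ _)) (N-⁻¹ x∈)

    ≈ε⇒∈N : ∀ {x} → x H.≈ H.ε → proj₁ x ∈ N
    ≈ε⇒∈N x≈ε = N-resp (trans (⁻¹-cong (identityʳ _)) (⁻¹-involutive _)) (N-⁻¹ x≈ε)

    ⁻¹∉N : ∀ {x} → x ∉ N → x ⁻¹ ∉ N
    ⁻¹∉N x∉ x⁻¹∈ = x∉ (N-resp (⁻¹-involutive _) (N-⁻¹ x⁻¹∈))

    ^∉N : ∀ {x z} → z ∈ K → x ∉ N → x ^ z ∉ N
    ^∉N {x} {z} z∈ x∉ x^z∈ = x∉ (N-resp (^-inverseˡ x z) (N-^ (K-⁻¹ z∈) x^z∈))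

    -- For `x` outside `N`, the factor `x ⁻¹ ∙ y` of `y = x ∙ (x ⁻¹ ∙ y)` lies in `N` and is
    -- absorbed.
    ≲ᴴ-reflexive : ∀ {x y} → x H.≈ y → x ≲ᴴ y
    ≲ᴴ-reflexive {x , x∈K} {y , y∈K} x~y with em {P = x ∈ N}
    ... | yes x∈N = inj₁ x∈N
    ... | no x∉N = inj₂
      ( (λ y∈N → x∉N (≈ε⇒∈N {x , x∈K} (H.trans {x , x∈K} {y , y∈K} {H.ε} x~y (∈N⇒≈ε {y , y∈K} y∈N))))
      , ≲-respʳ-≈ (\\-leftDividesˡ x y)
          (proj₂ (x⊏y⇒y∙x∼y (⊏-⊑-trans (to (∈G>⇔ γ) x~y) (∉N⇒γ⊑ x∉N)))))

    residueLaws : CQuasiOrderLaws (H γ) (Residue R γ)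
    residueLaws = record
      { isTotalPreorder = record
        { isPreorder = record
          { isEquivalence = H.isEquivalence
          ; reflexive = λ {x} {y} → ≲ᴴ-reflexive {x} {y}
          ; trans = λ { (inj₁ x∈) _ → inj₁ x∈
                      ; (inj₂ (y∉ , _)) (inj₁ y∈) → ⊥-elim (y∉ y∈)
                      ; (inj₂ (_ , x≲y)) (inj₂ (z∉ , y≲z)) → inj₂ (z∉ , ≲-trans x≲y y≲z) }
          }
        ; total = total
        }
      ; ≲ε⇒≈ε = λ { {x} (inj₁ x∈) → ∈N⇒≈ε {x} x∈ ; (inj₂ (ε∉ , _)) → ⊥-elim (ε∉ ε∈N) }
      ; ^-mono = λ { (z , z∈) (inj₁ x∈) → inj₁ (N-^ z∈ x∈)
                   ; (z , z∈) (inj₂ (y∉ , x≲y)) → inj₂ (^∉N z∈ y∉ , ^-mono z x≲y) }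
      ; ≲-cancel = λ { {x} {y} (inj₁ x//y∈) →
                        ≲ᴴ-reflexive {x} {y} (HP.x∙y⁻¹≈ε⇒x≈y x y (∈N⇒≈ε {x H.// y} x//y∈))
                     ; (inj₂ (y⁻¹∉ , le)) → inj₂ (y⁻¹∉ ∘ N-⁻¹ , ≲-cancel le) }
      }
      where
      total : ∀ x y → x ≲ᴴ y ⊎ y ≲ᴴ x
      total (x , _) (y , _) with em {P = x ∈ N} | em {P = y ∈ N}
      ... | yes x∈ | _ = inj₁ (inj₁ x∈)
      ... | no _ | yes y∈ = inj₂ (inj₁ y∈)
      ... | no x∉ | no y∉ = Sum.map (λ x≲y → inj₂ (y∉ , x≲y)) (λ y≲x → inj₂ (x∉ , y≲x)) (≲-total x y)

    residue-isValuational : V-type (rep γ) → IsValuational (H γ) (Residue R γ)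
    residue-isValuational vγ = isValuational em residueLaws λ (x , x∈) →
      [ inj₁ , (λ x∉ → inj₂ (⁻¹∉N x∉ ,
          proj₁ (V-type-resp-≋ vγ (∉N⇒γ⊑ x∉ , to ([γ]≤v⇔ γ) x∈)))) ]′ (toSum (em {P = x ∈ N}))

    IsValuational⇒V-type : IsValuational (H γ) (Residue R γ) → V-type (rep γ)
    IsValuational⇒V-type isVal =
      x≲x⁻¹ γ∉N (IsValuational⇒x≲x⁻¹ isVal (rep γ , γ∈K)) ,
      ≲-respʳ-≈ (⁻¹-involutive _)
        (x≲x⁻¹ (⁻¹∉N γ∉N) (IsValuational⇒x≲x⁻¹ isVal (rep γ ⁻¹ , K-⁻¹ γ∈K)))
      where
      γ∈K : rep γ ∈ K
      γ∈K = from ([γ]≤v⇔ γ) ⊑-refl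
      γ∉N : rep γ ∉ N
      γ∉N γ∈N = ⊏⇒⋣ (to (∈G>⇔ γ) γ∈N) ⊑-refl
      x≲x⁻¹ : ∀ {x} → x ∉ N → x ∈ N ⊎ (x ⁻¹ ∉ N × x ≲ x ⁻¹) → x ≲ x ⁻¹
      x≲x⁻¹ x∉ = [ ⊥-elim ∘ x∉ , proj₂ ]′

    -- Order-type residues.

    module _ {n} (n<n⁻¹ : n < n ⁻¹) (n≋γ : n ≋ rep γ) where

      K⇒∈upTo : ∀ {x} → x ∈ K → Cut upTo n x
      K⇒∈upTo x∈ = to (x⊑n⇔x∈upTo n<n⁻¹) (⊑-trans (to ([γ]≤v⇔ γ) x∈) (proj₂ n≋γ))

      N⇔∈below : ∀ {x} → x ∈ N ⇔ Cut below n x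
      N⇔∈below = mk⇔
        (λ x∈ → to (x⊏n⇔x∈below n<n⁻¹) (⊏-⊑-trans (to (∈G>⇔ γ) x∈) (proj₂ n≋γ)))
        (λ x∈ → from (∈G>⇔ γ) (⊏-⊑-trans (from (x⊏n⇔x∈below n<n⁻¹) x∈) (proj₁ n≋γ)))

      n<x⇒x∉N : ∀ {x} → n < x → x ∉ N
      n<x⇒x∉N n<x x∈ = n<x (proj₁ (to N⇔∈below x∈))

      n<x⇒x⁻¹≲n : ∀ {x} → x ∈ K → n < x → x ⁻¹ ≲ n
      n<x⇒x⁻¹≲n x∈ n<x = [ ⊥-elim ∘ n<x , id ]′ (K⇒∈upTo x∈)

      x∉N⇒n≲x : ∀ {x} → x ∉ N → n ≲ x
      x∉N⇒n≲x x∉ = dne λ x<n →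
        x∉ (from N⇔∈below (<⇒≲ x<n , <⇒≲ (x≲x⁻¹∧y<x⇒y⁻¹<x (<⇒≲ n<n⁻¹) x<n)))

      n<-∙ : ∀ {x y} → x ∈ K → n < x → n < y → n < x ∙ y
      n<-∙ {x} {y} x∈ n<x n<y xy≲n = n<y (≲-respˡ-≈ (\\-leftDividesʳ x y)
        (≲-∙-closed (<⇒≲ n<n⁻¹) (n<x⇒x⁻¹≲n x∈ n<x) xy≲n))

      -- `x ⁻¹ ≲ x` passes to conjugates, so `x ^ z ≲ n` would bring the inverse of `x ^ z` below
      -- `n` as well and put `x ^ z` into `N`.
      n<-^ : ∀ {x z} → x ∈ K → z ∈ K → n < x → n < x ^ z
      n<-^ {x} {z} x∈ z∈ n<x x^z≲n = ^∉N z∈ (n<x⇒x∉N n<x) (from N⇔∈below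
        (x^z≲n , ≲-trans (≲-respˡ-≈ (^-⁻¹-comm x z) (^-mono z x⁻¹≲x)) x^z≲n))
        where x⁻¹≲x = ≲-trans (n<x⇒x⁻¹≲n x∈ n<x) (<⇒≲ n<x)

      n<-resp-≈ᴴ : ∀ {x y} → x H.≈ y → n < proj₁ x → n < proj₁ y
      n<-resp-≈ᴴ {x , _} {y , _} x~y n<x y≲n = n<x (≲-respˡ-≈ y∙t⁻¹≈x
        (≲-∙-closed (<⇒≲ n<n⁻¹) y≲n (proj₂ (to N⇔∈below x~y))))
        where
        y∙t⁻¹≈x : y ∙ (x ⁻¹ ∙ y) ⁻¹ ≈ x
        y∙t⁻¹≈x = trans (∙-congˡ (⁻¹-anti-homo-\\ x y)) (\\-leftDividesˡ y x)

      n<-resp : ∀ {x y} → x ≈ y → n < x → n < y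
      n<-resp x≈y n<x y≲n = n<x (≲-respˡ-≈ (sym x≈y) y≲n)

      infix 4 _<ᴴ_
      -- The order with positive cone `n < g`; `Lift` only adjusts the level.
      _<ᴴ_ : Rel H.Carrier (c ⊔ ℓ ⊔ r)
      (x , _) <ᴴ (y , _) = Lift (c ⊔ ℓ ⊔ r) (n < y ∙ x ⁻¹)

      <ᴴ-irrefl : ∀ {x y} → x H.≈ y → ¬ x <ᴴ y
      <ᴴ-irrefl {x} {y} x~y (lift n<y//x) = n<x⇒x∉N n<y//x
        (≈ε⇒∈N {y H.// x} (HP.x≈y⇒x∙y⁻¹≈ε {y} {x} (H.sym {x} {y} x~y)))

      <ᴴ-trans : ∀ {x y z} → x <ᴴ y → y <ᴴ z → x <ᴴ z
      <ᴴ-trans {x , x∈} {y , y∈} {z , z∈} (lift x<y) (lift y<z) = lift (n<-resp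
        (trans (sym (assoc _ _ _)) (∙-congʳ (//-rightDividesˡ y z)))
        (n<-∙ (K-∙ z∈ (K-⁻¹ y∈)) y<z x<y))

      <ᴴ-isStrictTotalOrder : IsStrictTotalOrder H._≈_ _<ᴴ_
      <ᴴ-isStrictTotalOrder = record
        { isStrictPartialOrder = record
          { isEquivalence = H.isEquivalence
          ; irrefl        = λ {x} {y} → <ᴴ-irrefl {x} {y}
          ; trans         = λ {x} {y} {z} → <ᴴ-trans {x} {y} {z}
          ; <-resp-≈      =
              (λ {x} {y} {z} y~z (lift x<y) →
                lift (n<-resp-≈ᴴ {y H.// x} {z H.// x}
                  (H.∙-congʳ {x H.⁻¹} {y} {z} y~z) x<y))
            , (λ {x} {y} {z} y~z (lift y<x) →
                lift (n<-resp-≈ᴴ {x H.// y} {x H.// z}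
                  (H.∙-congˡ {x} {y H.⁻¹} {z H.⁻¹} (H.⁻¹-cong {y} {z} y~z)) y<x))
          }
        ; compare = compare
        }
        where
        compare : ∀ x y → Tri (x <ᴴ y) (x H.≈ y) (y <ᴴ x)
        compare x@(x₀ , x∈) y@(y₀ , y∈)
          with em {P = y₀ ∙ x₀ ⁻¹ ≲ n} | em {P = x₀ ∙ y₀ ⁻¹ ≲ n}
        ... | no n<y//x | _ = tri< (lift n<y//x) (λ x~y → <ᴴ-irrefl {x} {y} x~y (lift n<y//x))
          λ (lift n<x//y) → n<x//y (≲-respˡ-≈ (⁻¹-anti-homo-// y₀ x₀)
            (n<x⇒x⁻¹≲n (K-∙ y∈ (K-⁻¹ x∈)) n<y//x))
        ... | yes y//x≲n | no n<x//y = tri> (λ (lift n<y//x) → n<y//x y//x≲n)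
          (λ x~y → <ᴴ-irrefl {y} {x} (H.sym {x} {y} x~y) (lift n<x//y)) (lift n<x//y)
        ... | yes y//x≲n | yes x//y≲n = tri≈ (λ (lift n<y//x) → n<y//x y//x≲n)
          (HP.x∙y⁻¹≈ε⇒x≈y x y (∈N⇒≈ε {x H.// y} (from N⇔∈below
            (x//y≲n , ≲-respˡ-≈ (sym (⁻¹-anti-homo-// x₀ y₀)) y//x≲n))))
          (λ (lift n<x//y) → n<x//y x//y≲n)

      -- Write `a` for `x ∙ z ⁻¹` and `b` for `y ∙ z ⁻¹`, so `a ∙ b ⁻¹` is `x ∙ y ⁻¹`. If `b` is in
      -- `N`, then `y` and `z` agree. Otherwise `n ≲ b` and `n ≲ b ⁻¹`, so `a ≲ n` or `a ∙ b ⁻¹ ≲ n`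
      -- forces `a ≲ b`; conversely `n < a ≲ b` forces `a ∙ b ⁻¹ ≲ b ⁻¹ ≲ n`.
      C⇔<ᴴ : ∀ {x y z} →
        (¬ (x H.∙ z H.⁻¹) ≲ᴴ (y H.∙ z H.⁻¹)) ⇔ ((y <ᴴ x × z <ᴴ x) ⊎ (y H.≈ z × ¬ (z H.≈ x)))
      C⇔<ᴴ {x@(x₀ , x∈)} {y@(y₀ , y∈)} {z@(z₀ , z∈)} = mk⇔ to′ from′
        where
        a = x₀ ∙ z₀ ⁻¹
        b = y₀ ∙ z₀ ⁻¹

        a∙b⁻¹≈x∙y⁻¹ : a ∙ b ⁻¹ ≈ x₀ ∙ y₀ ⁻¹
        a∙b⁻¹≈x∙y⁻¹ = //-cancelʳ x₀ y₀ (z₀ ⁻¹)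

        to′ : ¬ (x H.∙ z H.⁻¹) ≲ᴴ (y H.∙ z H.⁻¹) → (y <ᴴ x × z <ᴴ x) ⊎ (y H.≈ z × ¬ (z H.≈ x))
        to′ a≴b with em {P = b ∈ N}
        ... | yes b∈ = inj₂
          ( HP.x∙y⁻¹≈ε⇒x≈y y z (∈N⇒≈ε {y H.// z} b∈)
          , λ z~x → a≴b (inj₁ (≈ε⇒∈N {x H.// z} (HP.x≈y⇒x∙y⁻¹≈ε {x} {z} (H.sym {z} {x} z~x)))))
        ... | no b∉ = inj₁
          ( lift (λ x//y≲n → a≴b (inj₂ (b∉ , ≲-cancel (≲-trans
              (≲-respˡ-≈ (sym a∙b⁻¹≈x∙y⁻¹) x//y≲n) (x∉N⇒n≲x (⁻¹∉N b∉))))))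
          , lift (λ a≲n → a≴b (inj₂ (b∉ , ≲-trans a≲n (x∉N⇒n≲x b∉)))))

        from′ : (y <ᴴ x × z <ᴴ x) ⊎ (y H.≈ z × ¬ (z H.≈ x)) → ¬ (x H.∙ z H.⁻¹) ≲ᴴ (y H.∙ z H.⁻¹)
        from′ (inj₁ (_ , lift n<a)) (inj₁ a∈) = n<x⇒x∉N n<a a∈
        from′ (inj₁ (lift n<x//y , lift n<a)) (inj₂ (b∉ , a≲b)) = n<x//y
          (≲-respˡ-≈ a∙b⁻¹≈x∙y⁻¹ (≲-trans (x≲y⇒x∙y⁻¹≲y⁻¹ a≲b)
            (n<x⇒x⁻¹≲n (K-∙ y∈ (K-⁻¹ z∈)) (λ b≲n → n<a (≲-trans a≲b b≲n)))))
        from′ (inj₂ (_ , z≁x)) (inj₁ a∈) =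
          z≁x (H.sym {x} {z} (HP.x∙y⁻¹≈ε⇒x≈y x z (∈N⇒≈ε {x H.// z} a∈)))
        from′ (inj₂ (y~z , _)) (inj₂ (b∉ , _)) =
          b∉ (≈ε⇒∈N {y H.// z} (HP.x≈y⇒x∙y⁻¹≈ε {y} {z} y~z))

      residue-isOrderType : IsOrderType (H γ) (Residue R γ)
      residue-isOrderType = record
        { isCQuasiOrder      = toCQuasiOrder em residueLaws
        ; _<_                = _<ᴴ_
        ; isStrictTotalOrder = <ᴴ-isStrictTotalOrder
        ; <-invˡ = λ { {x , x∈} {y , y∈} (z , z∈) (lift x<y) → lift (n<-resp
            (sym (//-cancelˡ y x z)) (n<-^ (K-∙ y∈ (K-⁻¹ x∈)) z∈ x<y)) }
        ; <-invʳ = λ { {x , _} {y , _} (z , _) (lift x<y) → lift (n<-resp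
            (sym (//-cancelʳ y x z)) x<y) }
        ; C⇔ = λ {x} {y} {z} → C⇔<ᴴ {x} {y} {z}
        }

    residue-isElementaryType : IsElementaryType (H γ) (Residue R γ)
    residue-isElementaryType = byType em em
      where
      byType : Dec (rep γ ≲ rep γ ⁻¹) → Dec (rep γ ⁻¹ ≲ rep γ) →
               IsElementaryType (H γ) (Residue R γ)
      byType (yes γ≲γ⁻¹) (yes γ⁻¹≲γ) = inj₂ (residue-isValuational (γ≲γ⁻¹ , γ⁻¹≲γ))
      byType (yes _) (no γ<γ⁻¹) = inj₁ (residue-isOrderType γ<γ⁻¹ (⊑-refl , ⊑-refl))
      -- The o⁻-type element here is the inverse of the representative.
      byType (no γ⁻¹<γ) _ = inj₁ (residue-isOrderType (x⁻¹<x⇒x⁻¹<x⁻¹⁻¹ γ⁻¹<γ) (x⁻¹⊑x , x⊑x⁻¹))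

  -- `α` is the value of an o⁻-type `n` separating the two v-type representatives; both inequalities
  -- are strict because no v-type element is `≋` to an o⁻-type one.
  orderType-between : ∀ γ δ → γ <ᵞ δ →
    IsValuational (H γ) (Residue R γ) → IsValuational (H δ) (Residue R δ) →
    ∃[ α ] γ <ᵞ α × α <ᵞ δ × IsOrderType (H α) (Residue R α)
  orderType-between γ δ (γ≤δ , γ≉δ) γ-val δ-val =
    between (V-type-separated vδ vγ (rep≉ε δ)
      (⋣⇒⊏ λ γ⊑δ → γ≉δ (Γ.antisym γ≤δ (from ≤⇔ γ⊑δ))))
    where
    vγ : V-type (rep γ)
    vγ = IsValuational⇒V-type γ γ-val
    vδ : V-type (rep δ)
    vδ = IsValuational⇒V-type δ δ-val
    between : ∃[ n ] n < n ⁻¹ × rep δ ≲ n × n < rep γ →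
              ∃[ α ] γ <ᵞ α × α <ᵞ δ × IsOrderType (H α) (Residue R α)
    between (n , n<n⁻¹ , δ≲n , n<γ) = α ,
      (from ≤⇔ (⊑-trans α⊑n (<⇒⊑ n<γ)) ,
       λ γ≈α → V-type∧≋⇒≮⁻¹ vγ
         (⊑-trans (to ≤⇔ (Γ.reflexive (Γ.Eq.sym γ≈α))) α⊑n , <⇒⊑ n<γ) n<n⁻¹) ,
      (from ≤⇔ (⊑-trans δ⊑n n⊑α) ,
       λ α≈δ → V-type∧≋⇒≮⁻¹ vδ
         (δ⊑n , ⊑-trans n⊑α (to ≤⇔ (Γ.reflexive (Γ.Eq.sym α≈δ)))) n<n⁻¹) ,
      residue-isOrderType α n<n⁻¹ (n⊑α , α⊑n)
      where
      ∃α = finite {n} λ n≈ε →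
        n<n⁻¹ (≲-reflexive (trans (⁻¹-cong n≈ε) (trans ε⁻¹≈ε (sym n≈ε))))
      α = proj₁ ∃α
      n⊑α : n ⊑ rep α
      n⊑α = proj₁ (to (v≈[γ]⇔ α) (proj₂ ∃α))
      α⊑n : rep α ⊑ n
      α⊑n = proj₂ (to (v≈[γ]⇔ α) (proj₂ ∃α))
      δ⊑n : rep δ ⊑ n
      δ⊑n = x<x⁻¹∧y≲x⇒y⊑x n<n⁻¹ δ≲n

  -- The lifting of the residues.

  infix 4 _≲ᴸ_ _≲ᵛ_
  -- `≲ᵛ` is the lifting rewritten without quotient groups.
  _≲ᴸ_ _≲ᵛ_ : Rel Carrier (c ⊔ ℓ ⊔ r)
  _≲ᴸ_ = Lifting (Residue R)
  x ≲ᵛ y = x ⊏ y ⊎ (x ≋ y × x ≲ y)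

  ≲ᴸ⇔≲ᵛ : ∀ x y → x ≲ᴸ y ⇔ x ≲ᵛ y
  ≲ᴸ⇔≲ᵛ x y = mk⇔ to′ from′
    where
    to′ : x ≲ᴸ y → x ≲ᵛ y
    to′ (inj₁ vy<vx) = inj₁ (⋣⇒⊏ (to v-<⇔ vy<vx))
    to′ (inj₂ (inj₁ (γ , vx≈γ , vy≈γ , res))) = atγ res
      where
      x≋γ = to (v≈[γ]⇔ γ) vx≈γ
      y≋γ = to (v≈[γ]⇔ γ) vy≈γ
      atγ : x ∈ G> γ ⊎ (y ∉ G> γ × x ≲ y) → x ≲ᵛ y
      atγ (inj₁ x∈N) = ⊥-elim (⊏⇒⋣ (to (∈G>⇔ γ) x∈N) (proj₂ x≋γ))
      atγ (inj₂ (_ , x≲y)) = inj₂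
        ((⊑-trans (proj₁ x≋γ) (proj₂ y≋γ) , ⊑-trans (proj₁ y≋γ) (proj₂ x≋γ)) , x≲y)
    to′ (inj₂ (inj₂ (x≈ε , y≈ε))) =
      inj₂ ((≈⇒⊑ x≈y , ≈⇒⊑ (sym x≈y)) , ≲-reflexive x≈y)
      where x≈y = trans x≈ε (sym y≈ε)

    from′ : x ≲ᵛ y → x ≲ᴸ y
    from′ (inj₁ x⊏y) = inj₁ (from v-<⇔ (⊏⇒⋣ x⊏y))
    from′ (inj₂ ((x⊑y , y⊑x) , x≲y)) = byCase em
      where
      byCase : Dec (x ≈ ε) → x ≲ᴸ y
      byCase (yes x≈ε) = inj₂ (inj₂ (x≈ε , ⊑ε⇒≈ε x≈ε y⊑x))
      byCase (no x≉ε) with γ , vx≈γ ← finite x≉ε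
                      with x⊑γ , γ⊑x ← to (v≈[γ]⇔ γ) vx≈γ =
        inj₂ (inj₁ (γ , vx≈γ , from (v≈[γ]⇔ γ) (⊑-trans y⊑x x⊑γ , ⊑-trans γ⊑x x⊑y) ,
          inj₂ ((λ y∈N → ⊏⇒⋣ (to (∈G>⇔ γ) y∈N) (⊑-trans γ⊑x x⊑y)) , x≲y)))

  ≲ᵛ⇒≲ : ∀ {x y} → x ≲ᵛ y → x ≲ y
  ≲ᵛ⇒≲ = [ ⊏⇒≲ , proj₂ ]′

  -- Together with `≲ᵛ⇒⊑` and `≲ᵛ⇒≲` this identifies `≲ᵛ` with the intersection of `⊑` and `≲`.
  ⊑∧≲⇒≲ᵛ : ∀ {x y} → x ⊑ y → x ≲ y → x ≲ᵛ y
  ⊑∧≲⇒≲ᵛ {x} {y} x⊑y x≲y with em {P = y ⊑ x}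
  ... | yes y⊑x = inj₂ ((x⊑y , y⊑x) , x≲y)
  ... | no y⋢x  = inj₁ (⋣⇒⊏ y⋢x)

  ≲ᵛ⇒⊑ : ∀ {x y} → x ≲ᵛ y → x ⊑ y
  ≲ᵛ⇒⊑ = [ ⊏⇒⊑ , proj₁ ∘ proj₁ ]′

  ≲ᵛ-laws : CQuasiOrderLaws G _≲ᵛ_
  ≲ᵛ-laws = record
    { isTotalPreorder = record
      { isPreorder = record
        { isEquivalence = isEquivalence
        ; reflexive = λ x≈y → inj₂ ((≈⇒⊑ x≈y , ≈⇒⊑ (sym x≈y)) , ≲-reflexive x≈y)
        ; trans = λ x≲y y≲z → ⊑∧≲⇒≲ᵛ (⊑-trans (≲ᵛ⇒⊑ x≲y) (≲ᵛ⇒⊑ y≲z))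
                                      (≲-trans (≲ᵛ⇒≲ x≲y) (≲ᵛ⇒≲ y≲z))
        }
      ; total = total
      }
    ; ≲ε⇒≈ε    = ≲ε⇒≈ε ∘ ≲ᵛ⇒≲
    ; ^-mono   = λ z x≲y → ⊑∧≲⇒≲ᵛ (⊑-^-mono z (≲ᵛ⇒⊑ x≲y)) (^-mono z (≲ᵛ⇒≲ x≲y))
    -- If `y ⊏ x`, then `x ⊑ x ∙ y ⁻¹ ⊑ y ⁻¹`, against `y ⁻¹ ⊏ x`.
    ; ≲-cancel = λ {x} {y} le → ⊑∧≲⇒≲ᵛ
        (dne λ x⋢y → ⊏⇒⋣ (⊑-⊏-trans x⁻¹⊑x (⋣⇒⊏ x⋢y)) (⊑-trans
          (x⊏y⇒y⊑y∙x (⊑-⊏-trans x⁻¹⊑x (⋣⇒⊏ x⋢y))) (≲ᵛ⇒⊑ le)))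
        (≲-cancel (≲ᵛ⇒≲ le))
    }
    where
    total : ∀ x y → x ≲ᵛ y ⊎ y ≲ᵛ x
    total x y with em {P = x ⊑ y} | em {P = y ⊑ x}
    ... | no x⋢y | _ = inj₂ (inj₁ (⋣⇒⊏ x⋢y))
    ... | yes _ | no y⋢x = inj₁ (inj₁ (⋣⇒⊏ y⋢x))
    ... | yes x⊑y | yes y⊑x = Sum.map (⊑∧≲⇒≲ᵛ x⊑y) (⊑∧≲⇒≲ᵛ y⊑x) (≲-total x y)

  ≲ᴸ-laws : CQuasiOrderLaws G _≲ᴸ_
  ≲ᴸ-laws = CQuasiOrderLaws-⇔ ≲ᴸ⇔≲ᵛ ≲ᵛ-laws

  private
    open IsTotalPreorder (CQuasiOrderLaws.isTotalPreorder ≲ᴸ-laws) using () renaming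
      (reflexive to ≲ᴸ-reflexive; ≲-respˡ-≈ to ≲ᴸ-respˡ-≈; ≲-respʳ-≈ to ≲ᴸ-respʳ-≈)

    ≲ᴸ⇒≲ : ∀ {x y} → x ≲ᴸ y → x ≲ y
    ≲ᴸ⇒≲ = ≲ᵛ⇒≲ ∘ to (≲ᴸ⇔≲ᵛ _ _)

  -- Recovering `≲` by welding.

  open Welding G _≲ᴸ_ using (M; Weldable; Weld)

  -- If `y ⁻¹ ≲ y`, then `y ≲ x ≲ y ⁻¹` makes `y` v-type, so the cut point `m` separating `x` from
  -- `y` has `m < y`. But `x ≲ m` gives `y ≲ m`, and `x ⁻¹ ≲ m` gives `x ⁻¹ < y ≲ x`, whence
  -- `y ≲ y ⁻¹ ≲ x ⁻¹ ≲ m`.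
  x⊏y∧y≲x⇒y<y⁻¹ : ∀ {x y} → x ⊏ y → y ≲ x → y < y ⁻¹
  x⊏y∧y≲x⇒y<y⁻¹ {x} {y} x⊏y@(s , m , m∈ , x∈ , y∉) y≲x y⁻¹≲y = m<y (y≲m s x∈)
    where
    y≲y⁻¹ : y ≲ y ⁻¹
    y≲y⁻¹ = ≲-trans y≲x (⊏⇒≲ (⊏-⊑-trans x⊏y x⊑x⁻¹))
    m<y : m < y
    m<y = y∉ ∘ V-type∧≲⇒Cut s (y≲y⁻¹ , y⁻¹≲y)
    y≲m : ∀ s → Cut s m x → y ≲ m
    y≲m below (x≲m , _) = ≲-trans y≲x x≲m
    y≲m upTo (inj₁ x≲m) = ≲-trans y≲x x≲m
    y≲m upTo (inj₂ x⁻¹≲m) = ≲-trans (≲-trans y≲y⁻¹ (n<k≲n⁻¹⇒k⁻¹≲n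
      (λ y≲x⁻¹ → m<y (≲-trans y≲x⁻¹ x⁻¹≲m)) (≲-respʳ-≈ (sym (⁻¹-involutive x)) y≲x))) x⁻¹≲m

  x⊏y∧y≲x⇒x∈M : ∀ {x y} → x ⊏ y → y ≲ x → x ∈ M y
  x⊏y∧y≲x⇒x∈M {x} {y} x⊏y y≲x =
    (from (≲ᴸ⇔≲ᵛ x y) (inj₁ x⊏y) , from (≲ᴸ⇔≲ᵛ _ y) (inj₁ (⊑-⊏-trans x⁻¹⊑x x⊏y))) ,
    λ {t} (t≲ᴸy , t⁻¹≲ᴸy) → from (≲ᴸ⇔≲ᵛ t x) (⊑∧≲⇒≲ᵛ
      (t⊑x (≲-trans (≲ᴸ⇒≲ t≲ᴸy) y≲x) (≲-trans (≲ᴸ⇒≲ t⁻¹≲ᴸy) y≲x))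
      (≲-trans (≲ᴸ⇒≲ t≲ᴸy) y≲x))
    where
    -- Otherwise `x ⊏ t`, and the previous lemma makes both `t` and `t ⁻¹` o⁻-type.
    t⊑x : ∀ {t} → t ≲ x → t ⁻¹ ≲ x → t ⊑ x
    t⊑x t≲x t⁻¹≲x = dne λ t⋢x → let x⊏t = ⋣⇒⊏ t⋢x in
      x⊏y∧y≲x⇒y<y⁻¹ (⊏-⊑-trans x⊏t x⊑x⁻¹) t⁻¹≲x
        (≲-respˡ-≈ (sym (⁻¹-involutive _)) (<⇒≲ (x⊏y∧y≲x⇒y<y⁻¹ x⊏t t≲x)))

  -- The weldable places of the lifting at which ≲ is in fact welded.
  W : Pred Carrier (c ⊔ ℓ ⊔ r)
  W g = g ∈ Weldable × (∀ z {m} → m ∈ M (g ^ z) → m ∼ g ^ z)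

  x⊏y∧y≲x⇒y∈W : ∀ {x y} → x ⊏ y → y ≲ x → y ∈ W
  x⊏y∧y≲x⇒y∈W {x} {y} x⊏y y≲x = (y⁻ , x , x∈M) , M∼
    where
    x∈M = x⊏y∧y≲x⇒x∈M x⊏y y≲x
    y<y⁻¹ = x⊏y∧y≲x⇒y<y⁻¹ x⊏y y≲x
    y⁻ = from (≲ᴸ⇔≲ᵛ _ _) (inj₂ ((x⊑x⁻¹ , x⁻¹⊑x) , <⇒≲ y<y⁻¹)) ,
         λ (_ , y⁻¹≲ᴸy) → y<y⁻¹ (≲ᴸ⇒≲ y⁻¹≲ᴸy)
    -- `x ^ z` is among the candidates that `m` dominates, so `y ^ z ≲ x ^ z ≲ m`.
    M∼ : ∀ z {m} → m ∈ M (y ^ z) → m ∼ y ^ z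
    M∼ z {m} ((m≲ᴸy^z , _) , maximal) =
      ≲ᴸ⇒≲ m≲ᴸy^z , ≲-trans (^-mono z y≲x) (≲ᴸ⇒≲ (maximal
        (x^z≲ᴸy^z (proj₁ (proj₁ x∈M)) , ≲ᴸ-respˡ-≈ (^-⁻¹-comm x z) (x^z≲ᴸy^z (proj₂ (proj₁ x∈M))))))
      where
      x^z≲ᴸy^z : ∀ {x y} → x ≲ᴸ y → x ^ z ≲ᴸ y ^ z
      x^z≲ᴸy^z = CQuasiOrderLaws.^-mono ≲ᴸ-laws z

  obtainedByWelding : ObtainedByWelding G _≲ᴸ_ R
  obtainedByWelding = toCQuasiOrder em ≲ᴸ-laws , W , proj₁ , λ x y → mk⇔ (to′ x y) (from′ x y)
    where
    to′ : ∀ x y → x ≲ y → Weld W x y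
    to′ x y x≲y = byCase em
      where
      M-resp : ∀ {g h k} → g ≈ h → k ∈ M g → k ∈ M h
      M-resp g≈h ((k≲g , k⁻¹≲g) , maximal) =
        (≲ᴸ-respʳ-≈ g≈h k≲g , ≲ᴸ-respʳ-≈ g≈h k⁻¹≲g) ,
        λ (t≲h , t⁻¹≲h) → maximal (≲ᴸ-respʳ-≈ (sym g≈h) t≲h , ≲ᴸ-respʳ-≈ (sym g≈h) t⁻¹≲h)

      byCase : Dec (x ⊑ y) → Weld W x y
      byCase (yes x⊑y) = inj₁ (from (≲ᴸ⇔≲ᵛ x y) (⊑∧≲⇒≲ᵛ x⊑y x≲y))
      -- Here `y ⊏ x` although `x ≲ y`, so the weld is made at `x` with trivial conjugator: `x` lies
      -- in its own class and `y` in `M x`.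
      byCase (no x⋢y) = inj₂ (x , ε , x⊏y∧y≲x⇒y∈W (⋣⇒⊏ x⋢y) x≲y ,
        inj₂ (≲ᴸ-reflexive (sym (x^ε≈x x)) , ≲ᴸ-reflexive (x^ε≈x x)) ,
        inj₁ (M-resp (sym (x^ε≈x x)) (x⊏y∧y≲x⇒x∈M (⋣⇒⊏ x⋢y) x≲y)))

    from′ : ∀ x y → Weld W x y → x ≲ y
    from′ x y (inj₁ x≲ᴸy) = ≲ᴸ⇒≲ x≲ᴸy
    from′ x y (inj₂ (g , z , (_ , M∼) , x∈ , y∈)) = ≲-trans (proj₁ (∼g^z x∈)) (proj₂ (∼g^z y∈))
      where
      ∼g^z : ∀ {k} → k ∈ M (g ^ z) ⊎ (k ≲ᴸ g ^ z × g ^ z ≲ᴸ k) → k ∼ g ^ z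
      ∼g^z (inj₁ k∈M) = M∼ z k∈M
      ∼g^z (inj₂ (k≲ , ≲k)) = ≲ᴸ⇒≲ k≲ , ≲ᴸ⇒≲ ≲k

theorem3p39 :
    (∀ {a} → ExcludedMiddle a) →
    ∀ {c ℓ r} (G : Group c ℓ) (_≲_ : Rel (Group.Carrier G) r) →
    IsCQuasiOrder G _≲_ →
    Σ[ Γ ∈ TotalOrder (c ⊔ ℓ) (c ⊔ ℓ ⊔ r) (c ⊔ ℓ ⊔ r) ]
    Σ[ V ∈ Valuation G Γ ]
      let open QuasiOrder _≲_
          open Types G _≲_
          open StrictOrder Γ
          open ResidueGroups V
      in
        IsTypeValuation V
      × (∀ γ → (IsSubgroup G (G≥ γ) × StrictlyConvex (G≥ γ))
             × (IsSubgroup G (G> γ) × StrictlyConvex (G> γ)))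
      × (∀ γ → IsElementaryType (H γ) (Residue _≲_ γ))
      × (∀ γ δ → γ < δ →
           IsValuational (H γ) (Residue _≲_ γ) → IsValuational (H δ) (Residue _≲_ δ) →
           ∃[ α ] γ < α × α < δ × IsOrderType (H α) (Residue _≲_ α))
      × ObtainedByWelding G (Lifting (Residue _≲_)) _≲_
theorem3p39 em G _≲_ isC = case typeValuation of λ { (Γ , V , V-⊑) →
    let open TypeValuation em laws V V-⊑
        open ResidueGroups V
    in
    Γ , V , isTypeValuation ,
    (λ γ → (G≥-isSubgroup γ , λ {s} {t} {x} → G≥-strictlyConvex γ {s} {t} {x}) ,
           (G>-isSubgroup γ , λ {s} {t} {x} → G>-strictlyConvex γ {s} {t} {x})) ,
    residue-isElementaryType , orderType-between , obtainedByWelding }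
  where
  laws = fromCQuasiOrder em isC
  open CQuasiOrderProperties em laws
  open PreorderValuation em G _⊑_ ⊑-isTotalPreorder ⊑ε⇒≈ε ⊑-//-closed ⊑-^-mono

  typeValuation : Σ[ Γ ∈ TotalOrder _ _ _ ] Σ[ V ∈ Valuation G Γ ] IsOrderedBy V _⊑_
  typeValuation = Γ , valuation , isOrderedBy
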